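{- Let $G$ be a simple balanced bipartite graph with color classes $A$ and $B$, $|A|=|B|=n$ (so $G$ has $2n$ vertices), and let $\delta=\delta(G)/n$, where $\delta(G)$ is the minimum degree of $G$. Assume $\delta\ge 1/2$ and set $\rho_0=\frac{\delta+\sqrt{2\delta-1}}{2}$. Then: (I) $G$ has a $\lfloor \rho_0 n\rfloor$-regular spanning subgraph. (II) Moreover, for every real $\delta>1/2$ the following holds: if $n$ is sufficiently large and $\delta n$ is an integer, then there exists a simple balanced bipartite graph $G_\delta$ on $2n$ vertices (color classes of size $n$ each) with minimum degree $\delta n$ such that $G_\delta$ has no $r$-regular spanning subgraph with $r>\lceil \rho_0 n\rceil$, where $\rho_0=\frac{\delta+\sqrt{2\delta-1}}{2}$.
   Context: A bipartite graph with color classes $A$ and $B$ is balanced if $|A|=|B|$. A spanning subgraph $H$ of $G$ is a subgraph with $V(H)=V(G)$; it is $r$-regular if every vertex of $H$ has degree exactly $r$ in $H$.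
   Formalization: In (II), δ is additionally required to satisfy δ ≤ 1; without this the claim fails (for δ = 2 no balanced bipartite graph with classes of size n has minimum degree 2n). -}

module Defs where

open import Data.Bool.Base using (Bool; T)
open import Data.Empty using (⊥; ⊥-elim)
open import Data.Fin.Base using (Fin; zero)
open import Data.Fin.Subset using (∣_∣)
open import Data.Integer.Base as ℤ using (ℤ; -[1+_]) renaming (+_ to ℤ⁺)
import Data.Integer.Properties as ℤ
open import Data.List.Base using (List; map; allFin; _++_)
open import Data.List.Extrema.Nat using (min)
open import Data.Nat.Base as ℕ using (ℕ; zero; suc)
import Data.Nat.Coprimality as Coprimality
import Data.Nat.Properties as ℕ
open import Data.Product.Base using (∃; ∃-syntax; _×_; _,_)
open import Data.Rational.Base hiding (∣_∣)
open import Data.Rational.Properties as ℚ using ()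
import Data.Rational.Unnormalised.Base as ℚᵘ
import Data.Rational.Unnormalised.Properties as ℚᵘ
open import Data.Rational.Solver using (module +-*-Solver)
open import Data.Sum.Base using (_⊎_; inj₁; inj₂)
open import Data.Vec.Base using (tabulate)
open import Relation.Binary.Definitions using (tri<; tri≈; tri>)
open import Relation.Binary.PropositionalEquality
  using (_≡_; refl; sym; trans; cong; cong₂; subst; subst₂)
open import Relation.Nullary using (yes; no)

------------------------------------------------------------------------
-- Dedekind real numbers

record ℝ : Set₁ where
  field
    lower upper     : ℚ → Set
    lower-inhabited : ∃ lower
    upper-inhabited : ∃ upper
    lower-closed    : ∀ {q r} → q < r → lower r → lower q
    upper-closed    : ∀ {q r} → q < r → upper q → upper r
    lower-open      : ∀ {q} → lower q → ∃[ r ] (q < r × lower r)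
    upper-open      : ∀ {r} → upper r → ∃[ q ] (q < r × upper q)
    disjoint        : ∀ {q} → lower q → upper q → ⊥
    located         : ∀ {q r} → q < r → lower q ⊎ upper r

open ℝ public

infix 4 _<ℝ_ _≤ℝ_ _≃ℝ_

_<ℝ_ _≤ℝ_ _≃ℝ_ : ℝ → ℝ → Set
x <ℝ y = ∃[ q ] (upper x q × lower y q)
x ≤ℝ y = ∀ q → lower x q → lower y q
x ≃ℝ y = x ≤ℝ y × y ≤ℝ x

q<q+1 : ∀ q → q < q + 1ℚ
q<q+1 q = subst (_< q + 1ℚ) (ℚ.+-identityʳ q) (ℚ.+-monoʳ-< q (ℚ.positive⁻¹ 1ℚ))

q-1<q : ∀ q → q - 1ℚ < q
q-1<q q = subst (q - 1ℚ <_) (ℚ.+-identityʳ q) (ℚ.+-monoʳ-< q (ℚ.negative⁻¹ (- 1ℚ)))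

lower<upper : ∀ x {a b} → lower x a → upper x b → a < b
lower<upper x {a} {b} la ub with ℚ.<-cmp a b
... | tri< a<b _ _ = a<b
... | tri≈ _ refl _ = ⊥-elim (disjoint x la ub)
... | tri> _ _ b<a = ⊥-elim (disjoint x la (upper-closed x b<a ub))

infixr 8 _×ᵣ_

_×ᵣ_ : ℕ → ℚ → ℚ
zero  ×ᵣ η = 0ℚ
suc k ×ᵣ η = η + k ×ᵣ η

×ᵣ-* : ∀ k η → (k ×ᵣ 1ℚ) * η ≡ k ×ᵣ η
×ᵣ-* zero    η = ℚ.*-zeroˡ η
×ᵣ-* (suc k) η = trans (ℚ.*-distribʳ-+ η 1ℚ (k ×ᵣ 1ℚ))
                       (cong₂ _+_ (ℚ.*-identityˡ η) (×ᵣ-* k η))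

ι : ℕ → ℚ
ι k = mkℚ (ℤ⁺ k) 0 (Coprimality.sym (Coprimality.1-coprimeTo k))

ι-suc : ∀ k → 1ℚ + ι k ≡ ι (suc k)
ι-suc k = ℚ.toℚᵘ-injective (ℚᵘ.≃-trans (ℚ.toℚᵘ-homo-+ 1ℚ (ι k)) (ℚᵘ.*≡* eq))
  where
  eq : (ℤ.1ℤ ℤ.+ (ℤ⁺ k) ℤ.* ℤ.1ℤ) ℤ.* ℤ.1ℤ ≡ ℤ⁺ (suc k) ℤ.* ℤ.1ℤ
  eq = cong (λ z → (ℤ.1ℤ ℤ.+ z) ℤ.* ℤ.1ℤ) (ℤ.*-identityʳ (ℤ⁺ k))

ι≡×ᵣ : ∀ k → ι k ≡ k ×ᵣ 1ℚ
ι≡×ᵣ zero    = refl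
ι≡×ᵣ (suc k) = trans (sym (ι-suc k)) (cong (1ℚ +_) (ι≡×ᵣ k))

below-ι : ∀ p → ∃[ k ] (p < ι k)
below-ι (mkℚ (ℤ⁺ n) d _)    = suc n , *<* (subst₂ ℤ._<_
    (ℤ.pos-* n 1) (ℤ.pos-* (suc n) (suc d))
    (ℤ.+<+ (ℕ.<-≤-trans (ℕ.*-monoˡ-< 1 (ℕ.n<1+n n)) (ℕ.*-monoʳ-≤ (suc n) (ℕ.s≤s (ℕ.z≤n {d}))))))
below-ι (mkℚ -[1+ n ] d _) = 1 , *<* ℤ.-<+

archimedean : ∀ p η .{{_ : Positive η}} → ∃[ k ] (p < k ×ᵣ η)
archimedean p η =
  let instance _ = ℚ.pos⇒nonZero η
      k , lt = below-ι (p ÷ η)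
  in k , subst₂ _<_
    (trans (ℚ.*-assoc p (1/ η) η) (trans (cong (p *_) (ℚ.*-inverseˡ η)) (ℚ.*-identityʳ p)))
    (trans (cong (_* η) (ι≡×ᵣ k)) (×ᵣ-* k η))
    (ℚ.*-monoˡ-<-pos η lt)

walk : ∀ x {η} → 0ℚ < η → ∀ k {a} → lower x a → upper x (a + k ×ᵣ η) →
       ∃[ b ] (lower x b × upper x (b + (η + η)))
walk x 0<η zero {a} la ua =
  ⊥-elim (disjoint x la (subst (upper x) (ℚ.+-identityʳ a) ua))
walk x {η} 0<η (suc k) {a} la ua with located x {a + η} {a + (η + η)}
  (ℚ.+-monoʳ-< a (subst (_< η + η) (ℚ.+-identityʳ η) (ℚ.+-monoʳ-< η 0<η)))
... | inj₁ la+η  = walk x 0<η k la+η (subst (upper x) (sym (ℚ.+-assoc a η (k ×ᵣ η))) ua)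
... | inj₂ ua+2η = a , la , ua+2η

halves : ∀ ε → ½ * ε + ½ * ε ≡ ε
halves ε = trans (sym (ℚ.*-distribʳ-+ ε ½ ½)) (ℚ.*-identityˡ ε)

approximate : ∀ x {ε} → 0ℚ < ε → ∃[ a ] (lower x a × upper x (a + ε))
approximate x {ε} 0<ε =
  let instance _ = positive 0<ε
      η = ½ * ε
      instance η>0 : Positive η
               η>0 = ℚ.pos*pos⇒pos ½ ε
      a₀ , la₀ = lower-inhabited x
      b₀ , ub₀ = upper-inhabited x
      k , b₀-a₀<kη = archimedean (b₀ - a₀) η
      b₀<a₀+kη = subst (_< a₀ + k ×ᵣ η) (cancel a₀ b₀) (ℚ.+-monoʳ-< a₀ b₀-a₀<kη)
      a , la , ua = walk x (ℚ.positive⁻¹ η) k la₀ (upper-closed x b₀<a₀+kη ub₀)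
  in a , la , subst (λ e → upper x (a + e)) (halves ε) ua
  where
  open +-*-Solver
  cancel : ∀ a b → a + (b - a) ≡ b
  cancel = solve 2 (λ a b → a :+ (b :- a) := b) refl

fromℚ : ℚ → ℝ
fromℚ p = record
  { lower           = _< p
  ; upper           = p <_
  ; lower-inhabited = p - 1ℚ , q-1<q p
  ; upper-inhabited = p + 1ℚ , q<q+1 p
  ; lower-closed    = ℚ.<-trans
  ; upper-closed    = λ q<r p<q → ℚ.<-trans p<q q<r
  ; lower-open      = λ q<p → let m , q<m , m<p = ℚ.<-dense q<p in m , q<m , m<p
  ; upper-open      = λ p<r → let m , p<m , m<r = ℚ.<-dense p<r in m , m<r , p<m
  ; disjoint        = ℚ.<-asym
  ; located         = split
  }
  where
  split : ∀ {q r} → q < r → q < p ⊎ p < r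
  split {q} q<r with q ℚ.<? p
  ... | yes q<p = inj₁ q<p
  ... | no  q≮p = inj₂ (ℚ.≤-<-trans (ℚ.≮⇒≥ q≮p) q<r)

fromℤ : ℤ → ℝ
fromℤ k = fromℚ (k / 1)

infixl 6 _+ℝ_
infixr 7 _·_ _·ℕ_
infixr 8 √_

_+ℝ_ : ℝ → ℝ → ℝ
x +ℝ y = record
  { lower           = λ q → ∃[ a ] ∃[ b ] (lower x a × lower y b × q < a + b)
  ; upper           = λ q → ∃[ a ] ∃[ b ] (upper x a × upper y b × a + b < q)
  ; lower-inhabited =
      let a , la = lower-inhabited x
          b , lb = lower-inhabited y
      in a + b - 1ℚ , a , b , la , lb , q-1<q (a + b)
  ; upper-inhabited =
      let a , ua = upper-inhabited x
          b , ub = upper-inhabited y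
      in a + b + 1ℚ , a , b , ua , ub , q<q+1 (a + b)
  ; lower-closed    = λ { q<r (a , b , la , lb , r<a+b) →
      a , b , la , lb , ℚ.<-trans q<r r<a+b }
  ; upper-closed    = λ { q<r (a , b , ua , ub , a+b<q) →
      a , b , ua , ub , ℚ.<-trans a+b<q q<r }
  ; lower-open      = λ { (a , b , la , lb , q<a+b) →
      let m , q<m , m<a+b = ℚ.<-dense q<a+b
      in m , q<m , a , b , la , lb , m<a+b }
  ; upper-open      = λ { (a , b , ua , ub , a+b<q) →
      let m , a+b<m , m<q = ℚ.<-dense a+b<q
      in m , m<q , a , b , ua , ub , a+b<m }
  ; disjoint        = λ { (a , b , la , lb , q<a+b) (a′ , b′ , ua , ub , a′+b′<q) →
      ℚ.<-asym (ℚ.+-mono-< (lower<upper x la ua) (lower<upper y lb ub))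
               (ℚ.<-trans a′+b′<q q<a+b) }
  ; located         = split
  }
  where
  open +-*-Solver

  Lower Upper : ℚ → Set
  Lower q = ∃[ a ] ∃[ b ] (lower x a × lower y b × q < a + b)
  Upper q = ∃[ a ] ∃[ b ] (upper x a × upper y b × a + b < q)

  cancel : ∀ a q → a + (q - a) ≡ q
  cancel = solve 2 (λ a q → a :+ (q :- a) := q) refl

  split : ∀ {q r} → q < r → Lower q ⊎ Upper r
  split {q} {r} q<r =
    let m , q<m , m<r = ℚ.<-dense q<r
        0<m-q = subst (_< m - q) (ℚ.+-inverseʳ q) (ℚ.+-monoˡ-< (- q) q<m)
        a , la , ua = approximate x 0<m-q
        a′ = a + (m - q)
        q-a≡m-a′ = solve 3 (λ q m a → q :- a := m :- (a :+ (m :- q))) refl q m a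
    in decide a a′ la ua (subst (_< r - a′) (sym q-a≡m-a′) (ℚ.+-monoˡ-< (- a′) m<r))
    where
    decide : ∀ a a′ → lower x a → upper x a′ → q - a < r - a′ → Lower q ⊎ Upper r
    decide a a′ la ua lt with located y lt
    ... | inj₁ lb = let b , q-a<b , lb′ = lower-open y lb in
      inj₁ (a , b , la , lb′ , subst (_< a + b) (cancel a q) (ℚ.+-monoʳ-< a q-a<b))
    ... | inj₂ ub = let b , b<r-a′ , ub′ = upper-open y ub in
      inj₂ (a′ , b , ua , ub′ , subst (a′ + b <_) (cancel a′ r) (ℚ.+-monoʳ-< a′ b<r-a′))

-- Multiplication by a positive rational: q < c · x iff q ÷ c < x.
_·_ : (c : ℚ) .{{_ : Positive c}} → ℝ → ℝ
c · x = record
  { lower           = λ q → lower x (q ÷ c)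
  ; upper           = λ q → upper x (q ÷ c)
  ; lower-inhabited = let a , la = lower-inhabited x in
      a * c , subst (lower x) (sym (*-÷ a)) la
  ; upper-inhabited = let a , ua = upper-inhabited x in
      a * c , subst (upper x) (sym (*-÷ a)) ua
  ; lower-closed    = λ q<r → lower-closed x (÷-mono q<r)
  ; upper-closed    = λ q<r → upper-closed x (÷-mono q<r)
  ; lower-open      = λ {q} l → let a , q÷c<a , la = lower-open x l in
      a * c , subst (_< a * c) (÷-* q) (ℚ.*-monoˡ-<-pos c q÷c<a)
            , subst (lower x) (sym (*-÷ a)) la
  ; upper-open      = λ {q} u → let a , a<q÷c , ua = upper-open x u in
      a * c , subst (a * c <_) (÷-* q) (ℚ.*-monoˡ-<-pos c a<q÷c)
            , subst (upper x) (sym (*-÷ a)) ua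
  ; disjoint        = disjoint x
  ; located         = λ q<r → located x (÷-mono q<r)
  }
  where
  instance
    c≢0 : NonZero c
    c≢0 = ℚ.pos⇒nonZero c

  *-÷ : ∀ a → (a * c) ÷ c ≡ a
  *-÷ a = trans (ℚ.*-assoc a c (1/ c)) (trans (cong (a *_) (ℚ.*-inverseʳ c)) (ℚ.*-identityʳ a))

  ÷-* : ∀ a → (a ÷ c) * c ≡ a
  ÷-* a = trans (ℚ.*-assoc a (1/ c) c) (trans (cong (a *_) (ℚ.*-inverseˡ c)) (ℚ.*-identityʳ a))

  ÷-mono : ∀ {q r} → q < r → q ÷ c < r ÷ c
  ÷-mono = ℚ.*-monoˡ-<-pos (1/ c) {{ℚ.1/pos⇒pos c}}

_·ℕ_ : (n : ℕ) .{{_ : ℕ.NonZero n}} → ℝ → ℝ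
n ·ℕ x = _·_ (ℤ⁺ n / 1) {{ℚ.normalize-pos n 1}} x

square-mono : ∀ {a b} → 0ℚ ≤ a → a < b → a * a < b * b
square-mono {a} {b} 0≤a a<b =
  ℚ.≤-<-trans (ℚ.*-monoˡ-≤-nonNeg a {{nonNegative 0≤a}} (ℚ.<⇒≤ a<b))
              (ℚ.*-monoˡ-<-pos b {{positive (ℚ.≤-<-trans 0≤a a<b)}} a<b)

-- The square root of max(x, 0). The auxiliary rational a makes the cuts open by
-- density of ℚ.
√_ : ℝ → ℝ
√ x = record
  { lower           = Lower
  ; upper           = Upper
  ; lower-inhabited = - 1ℚ , inj₁ (ℚ.negative⁻¹ (- 1ℚ))
  ; upper-inhabited = top
  ; lower-closed    = λ { q<r (inj₁ r<0) → inj₁ (ℚ.<-trans q<r r<0)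
                        ; q<r (inj₂ (a , 0≤a , r<a , la)) → inj₂ (a , 0≤a , ℚ.<-trans q<r r<a , la) }
  ; upper-closed    = λ { q<r (a , 0<a , a<q , ua) → a , 0<a , ℚ.<-trans a<q q<r , ua }
  ; lower-open      = λ
      { (inj₁ q<0) → let m , q<m , m<0 = ℚ.<-dense q<0 in m , q<m , inj₁ m<0
      ; (inj₂ (a , 0≤a , q<a , la)) →
          let m , q<m , m<a = ℚ.<-dense q<a in m , q<m , inj₂ (a , 0≤a , m<a , la) }
  ; upper-open      = λ { (a , 0<a , a<q , ua) →
      let m , a<m , m<q = ℚ.<-dense a<q in m , m<q , a , 0<a , a<m , ua }
  ; disjoint        = λ
      { (inj₁ q<0) (b , 0<b , b<q , _) → ℚ.<-asym 0<b (ℚ.<-trans b<q q<0)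
      ; (inj₂ (a , 0≤a , q<a , la)) (b , 0<b , b<q , ub) →
          ℚ.<-asym (lower<upper x la ub) (square-mono (ℚ.<⇒≤ 0<b) (ℚ.<-trans b<q q<a)) }
  ; located         = split
  }
  where
  Lower Upper : ℚ → Set
  Lower q = q < 0ℚ ⊎ ∃[ a ] (0ℚ ≤ a × q < a × lower x (a * a))
  Upper q = ∃[ a ] (0ℚ < a × a < q × upper x (a * a))

  0<1 : 0ℚ < 1ℚ
  0<1 = ℚ.positive⁻¹ 1ℚ

  top : ∃ Upper
  top with upper-inhabited x
  ... | u , ux with u ℚ.<? 1ℚ
  ...   | yes u<1 = 1ℚ + 1ℚ , 1ℚ , 0<1 , q<q+1 1ℚ , upper-closed x u<1 ux
  ...   | no  u≮1 = a + 1ℚ , a , 0<a , q<q+1 a , upper-closed x u<a² ux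
    where
    a = u + 1ℚ
    1<a : 1ℚ < a
    1<a = ℚ.≤-<-trans (ℚ.≮⇒≥ u≮1) (q<q+1 u)
    0<a : 0ℚ < a
    0<a = ℚ.<-trans 0<1 1<a
    u<a² : u < a * a
    u<a² = ℚ.<-trans (q<q+1 u)
      (subst (_< a * a) (ℚ.*-identityˡ a) (ℚ.*-monoˡ-<-pos a {{positive 0<a}} 1<a))

  split : ∀ {q r} → q < r → Lower q ⊎ Upper r
  split {q} {r} q<r with q ℚ.<? 0ℚ
  ... | yes q<0 = inj₁ (inj₁ q<0)
  ... | no  q≮0 with ℚ.<-dense q<r
  ...   | m , q<m , m<r with ℚ.<-dense m<r
  ...     | m′ , m<m′ , m′<r with located x (square-mono 0≤m m<m′)
    where
    0≤m : 0ℚ ≤ m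
    0≤m = ℚ.<⇒≤ (ℚ.≤-<-trans (ℚ.≮⇒≥ q≮0) q<m)
  ...       | inj₁ l = inj₁ (inj₂ (m , ℚ.<⇒≤ (ℚ.≤-<-trans (ℚ.≮⇒≥ q≮0) q<m) , q<m , l))
  ...       | inj₂ u = inj₂ (m′ , ℚ.≤-<-trans (ℚ.≮⇒≥ q≮0) (ℚ.<-trans q<m m<m′) , m′<r , u)

-- The floor and ceiling of a real number are given by their graphs, since they
-- are not computable functions on ℝ.
IsFloor IsCeiling : ℤ → ℝ → Set
IsFloor   k x = fromℤ k ≤ℝ x × x <ℝ fromℤ (ℤ.suc k)
IsCeiling k x = fromℤ (ℤ.pred k) <ℝ x × x ≤ℝ fromℤ k

IsInteger : ℝ → Set
IsInteger x = ∃[ k ] (x ≃ℝ fromℤ k)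

ρ₀ : ℝ → ℝ
ρ₀ δ = ½ · (δ +ℝ √ (2 ·ℕ δ +ℝ fromℚ (- 1ℚ)))

------------------------------------------------------------------------
-- Bipartite graphs

-- A simple bipartite graph with colour classes Fin a and Fin b is a set of
-- edges E ⊆ Fin a × Fin b, which leaves no room for loops or multiple edges.
record BipartiteGraph (a b : ℕ) : Set where
  field
    edge : Fin a → Fin b → Bool

open BipartiteGraph public

Balanced : ℕ → Set
Balanced n = BipartiteGraph n n

module _ {a b : ℕ} where

  Vertex : Set
  Vertex = Fin a ⊎ Fin b

  vertices : List Vertex
  vertices = map inj₁ (allFin a) ++ map inj₂ (allFin b)

  degree : BipartiteGraph a b → Vertex → ℕ
  degree G (inj₁ i) = ∣ tabulate (λ j → edge G i j) ∣
  degree G (inj₂ j) = ∣ tabulate (λ i → edge G i j) ∣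

  _IsSpanningSubgraphOf_ : BipartiteGraph a b → BipartiteGraph a b → Set
  H IsSpanningSubgraphOf G = ∀ i j → T (edge H i j) → T (edge G i j)

  Regular : ℕ → BipartiteGraph a b → Set
  Regular r H = ∀ v → degree H v ≡ r

  HasRegularSpanningSubgraph : ℕ → BipartiteGraph a b → Set
  HasRegularSpanningSubgraph r G = ∃[ H ] (H IsSpanningSubgraphOf G × Regular r H)

minDegree : ∀ {a b} .{{_ : ℕ.NonZero a}} → BipartiteGraph a b → ℕ
minDegree {suc a} G = min (degree G (inj₁ zero)) (map (degree G) vertices)

{-# OPTIONS --safe #-}

-- Existence. A bipartite graph has a subgraph with prescribed row degrees f and column
-- degrees g (of equal total) as soon as f(S) ≤ e(S, Uᶜ) + g(U) for all S and U: edges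
-- are discarded or selected one at a time, and submodularity of the cut function shows
-- that one of the two preserves the condition. For f = g = r, minimum degree d, |S| = s
-- and |U| = y, counting edges from either side reduces the condition to
-- (s − r)(d − r − y) + r (d − r) ≥ 0, which follows from 4 r (d − r) + 1 ≥ (n − d)²;
-- up to rounding this says 2 r ≤ d + √(n (2d − n)) = 2 ρ₀ n.
--
-- Sharpness. Join x vertices on either side to everything and let the remaining
-- vertices induce a (d − x)-regular graph, which exists by the same criterion. Counting
-- the edges of an r-regular subgraph at the remaining vertices gives
-- r (n − 2x) ≤ (n − x)(d − x), which fails for r > ⌈ρ₀ n⌉ if x is close to (n + d) / 2 − r.
module Submission where

open import Defs

-- Neither the floor nor the ceiling of a Dedekind real can be computed, so both halves are carried
-- out in the integers. In (I) and in (II) `d = δ n` is an integer, and an integer `z` is compared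
-- with `ρ₀ n` through the sign of `2 z − d` and the size of `(2 z − d)²` against `n (2 d − n)`,
-- which is decidable. The cuts of the reals are opened only to justify this dictionary.
--
-- Rounding is paid for by integrality. The floor `r` of `ρ₀ n` may satisfy `2 r = d − 1`, and then
-- `(2 r − d)²` can exceed `n (2 d − n)` by 1; likewise the best `x` for the extremal graph may be a
-- half-integer. In both places the loss is at most one quarter, and an integer that is at least
-- `− 1 / 4` is nonnegative.

module RegularSubgraphs where

  import Algebra.Properties.Semiring.Sum
  open import Data.Bool.Base using (Bool; true; false; T; _∧_; _∨_; not)
  open import Data.Bool.Properties using (∧-identityʳ; ∨-identityʳ; T?)
  open import Data.Empty using (⊥; ⊥-elim)
  open import Data.Fin.Base using (Fin; zero; suc; toℕ; fromℕ)
  open import Data.Fin.Properties using (_≟_; toℕ-fromℕ)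
  import Data.Fin.Subset as Subset
  open import Data.Fin.Subset.Properties using (anySubset?)
  open import Data.Integer.Base hiding (suc)
  open import Data.Integer.Properties as ℤ hiding (_≟_)
  open import Data.Integer.Tactic.RingSolver using (solve-∀)
  open import Data.List.Base using (List; []; _∷_; allFin; cartesianProduct; map)
  open import Data.List.Extrema.Nat using (min≤v⁺; v≤min⁺)
  open import Data.List.Membership.Propositional using (_∈_)
  open import Data.List.Membership.Propositional.Properties
    using (∈-cartesianProduct⁺; ∈-allFin; ∈-map⁺; ∈-++⁺ˡ; ∈-++⁺ʳ)
  import Data.List.Relation.Unary.All as All
  import Data.List.Relation.Unary.All.Properties as All
  open import Data.List.Relation.Unary.Any as Any using (here; there)
  open import Data.Nat.Base as ℕ using (ℕ)
  import Data.Nat.Properties as ℕ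
  open import Data.Product.Base using (∃; ∃₂; _×_; _,_)
  open import Data.Sum.Base using (_⊎_; inj₁; inj₂; [_,_]′)
  open import Data.Unit.Base using (tt)
  open import Data.Vec.Base using (lookup; tabulate)
  open import Data.Vec.Properties using (lookup∘tabulate)
  open import Function.Base using (_∘_; id; case_of_)
  open import Relation.Binary.PropositionalEquality
  open import Relation.Nullary using (Dec; yes; no; does; ¬_)

  module ∑ = Algebra.Properties.Semiring.Sum ℤ.+-*-semiring

  private variable
    m n : ℕ

  -- Indicator sums and integer inequalities

  ⟦_⟧ : Bool → ℤ
  ⟦ true  ⟧ = 1ℤ
  ⟦ false ⟧ = 0ℤ

  0≤⟦_⟧ : ∀ x → 0ℤ ≤ ⟦ x ⟧
  0≤⟦ true  ⟧ = +≤+ ℕ.z≤n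
  0≤⟦ false ⟧ = +≤+ ℕ.z≤n

  ⟦⟧-not : ∀ x → ⟦ not x ⟧ ≡ 1ℤ - ⟦ x ⟧
  ⟦⟧-not true  = refl
  ⟦⟧-not false = refl

  ⟦⟧-∧ : ∀ x y → ⟦ x ∧ y ⟧ ≡ ⟦ x ⟧ * ⟦ y ⟧
  ⟦⟧-∧ true  y = sym (*-identityˡ ⟦ y ⟧)
  ⟦⟧-∧ false y = refl

  ⟦⟧-∨ : ∀ x y → ⟦ x ∨ y ⟧ ≡ ⟦ x ⟧ + ⟦ y ⟧ - ⟦ x ⟧ * ⟦ y ⟧
  ⟦⟧-∨ true  true  = refl
  ⟦⟧-∨ true  false = refl
  ⟦⟧-∨ false true  = refl
  ⟦⟧-∨ false false = refl

  0≤+ : ∀ {x y} → 0ℤ ≤ x → 0ℤ ≤ y → 0ℤ ≤ x + y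
  0≤+ = +-mono-≤

  0≤* : ∀ {x y} → 0ℤ ≤ x → 0ℤ ≤ y → 0ℤ ≤ x * y
  0≤* {x} {y} 0≤x 0≤y = subst (_≤ x * y) (*-zeroʳ x) (*-monoˡ-≤-nonNeg x {{nonNegative 0≤x}} 0≤y)

  0≤1-⟦_⟧ : ∀ x → 0ℤ ≤ 1ℤ - ⟦ x ⟧
  0≤1-⟦ x ⟧ = subst (0ℤ ≤_) (⟦⟧-not x) 0≤⟦ not x ⟧

  -- Inequalities are proved by certificates: `z` is a combination of visibly nonnegative terms, and
  -- the ring solver checks that it equals the difference. Contradictions have the same shape, with
  -- nonnegative terms adding up to `-1` (see `0≰-1`).
  certify : ∀ {x y z} → 0ℤ ≤ z → y - x ≡ z → x ≤ y
  certify 0≤z eq = 0≤i-j⇒j≤i (subst (0ℤ ≤_) (sym eq) 0≤z)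

  <⇒0≤ : ∀ {x y} → x < y → 0ℤ ≤ y - x - 1ℤ
  <⇒0≤ {x} {y} x<y = subst (0ℤ ≤_) (eq x y) (i≤j⇒0≤j-i (i<j⇒suc[i]≤j x<y))
    where
    eq : ∀ x y → y - (1ℤ + x) ≡ y - x - 1ℤ
    eq = solve-∀

  0≰-1 : ∀ {z} → 0ℤ ≤ z → ¬ z ≡ -1ℤ
  0≰-1 () refl

  opaque
    sum : (Fin n → ℤ) → ℤ
    sum = ∑.sum

    sum-cong : {f g : Fin n → ℤ} → f ≗ g → sum f ≡ sum g
    sum-cong = ∑.sum-cong-≗

    sum-+ : (f g : Fin n → ℤ) → sum (λ i → f i + g i) ≡ sum f + sum g
    sum-+ = ∑.∑-distrib-+

    sum-comm : (φ : Fin m → Fin n → ℤ) → sum (λ i → sum (φ i)) ≡ sum (λ j → sum (λ i → φ i j))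
    sum-comm = ∑.∑-comm

    sum-*ˡ : ∀ x (f : Fin n → ℤ) → x * sum f ≡ sum (λ i → x * f i)
    sum-*ˡ = ∑.*-distribˡ-sum

    sum-const : ∀ n x → sum {n} (λ _ → x) ≡ + n * x
    sum-const ℕ.zero    x = refl
    sum-const (ℕ.suc n) x = trans (cong (_+_ x) (sum-const n x)) (sym (suc-* (+ n) x))

    sum-mono : {f g : Fin n → ℤ} → (∀ i → f i ≤ g i) → sum f ≤ sum g
    sum-mono {ℕ.zero}  f≤g = ≤-refl
    sum-mono {ℕ.suc n} f≤g = +-mono-≤ (f≤g zero) (sum-mono (f≤g ∘ suc))

    sum-zero : {f : Fin n → ℤ} → (∀ i → f i ≡ 0ℤ) → sum f ≡ 0ℤ
    sum-zero {n} f≡0 = trans (sum-cong f≡0) (∑.sum-replicate-zero n)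

  sum-nonNeg : {f : Fin n → ℤ} → (∀ i → 0ℤ ≤ f i) → 0ℤ ≤ sum f
  sum-nonNeg {n} {f} 0≤f = subst (_≤ sum f) (sum-zero {n} {λ _ → 0ℤ} (λ _ → refl)) (sum-mono 0≤f)

  sum-minus : (f g : Fin n → ℤ) → sum (λ i → f i - g i) ≡ sum f - sum g
  sum-minus f g = begin
    sum (λ i → f i - g i)                     ≡⟨ alg (sum (λ i → f i - g i)) (sum g) ⟩
    sum (λ i → f i - g i) + sum g - sum g     ≡⟨ cong (_- sum g) (sum-+ (λ i → f i - g i) g) ⟨
    sum (λ i → f i - g i + g i) - sum g       ≡⟨ cong (_- sum g) (sum-cong (λ i → alg′ (f i) (g i))) ⟩
    sum f - sum g                             ∎
    where
    open ≡-Reasoning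
    alg : ∀ x y → x ≡ x + y - y
    alg = solve-∀
    alg′ : ∀ x y → x - y + y ≡ x
    alg′ = solve-∀

  -- The Kronecker delta, unrelated to the density `δ` of the theorem.
  δ : Fin n → Fin n → ℤ
  δ a i = ⟦ does (i ≟ a) ⟧

  opaque
    unfolding sum

    sum-δ : ∀ (a : Fin n) (φ : Fin n → ℤ) → sum (λ i → δ a i * φ i) ≡ φ a
    sum-δ {ℕ.suc n} zero    φ = trans
      (cong₂ _+_ (*-identityˡ (φ zero)) (sum-zero {n} {λ i → 0ℤ * φ (suc i)} (λ i → refl)))
      (+-identityʳ (φ zero))
    sum-δ {ℕ.suc n} (suc a) φ = trans
      (+-identityˡ (sum (λ i → δ a i * φ (suc i))))
      (sum-δ a (λ i → φ (suc i)))

  sum-δ₁ : ∀ (a : Fin n) → sum (δ a) ≡ 1ℤ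
  sum-δ₁ a = trans (sum-cong (λ i → sym (*-identityʳ (δ a i)))) (sum-δ a (λ _ → 1ℤ))

  weight : (Fin n → ℤ) → (Fin n → Bool) → ℤ
  weight f S = sum (λ i → f i * ⟦ S i ⟧)

  weight-cong : ∀ (f : Fin n → ℤ) {S S′} → S ≗ S′ → weight f S ≡ weight f S′
  weight-cong f S≗S′ = sum-cong (λ i → cong (λ x → f i * ⟦ x ⟧) (S≗S′ i))

  weight-minus : ∀ (f g : Fin n → ℤ) S → weight (λ i → f i - g i) S ≡ weight f S - weight g S
  weight-minus f g S = trans (sum-cong (λ i → alg (f i) (g i) ⟦ S i ⟧))
    (sum-minus (λ i → f i * ⟦ S i ⟧) (λ i → g i * ⟦ S i ⟧))
    where
    alg : ∀ x y z → (x - y) * z ≡ x * z - y * z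
    alg = solve-∀

  weight-minus-δ : ∀ (f : Fin n → ℤ) a S → weight (λ i → f i - δ a i) S ≡ weight f S - ⟦ S a ⟧
  weight-minus-δ f a S = trans (weight-minus f (δ a) S) (cong (_-_ (weight f S)) (sum-δ a (λ i → ⟦ S i ⟧)))

  weight-full : ∀ (f : Fin n → ℤ) → weight f (λ _ → true) ≡ sum f
  weight-full f = sum-cong (λ i → *-identityʳ (f i))

  weight-empty : ∀ (f : Fin n → ℤ) → weight f (λ _ → false) ≡ 0ℤ
  weight-empty f = sum-zero (λ i → *-zeroʳ (f i))

  weight-except : ∀ (f : Fin n → ℤ) a → weight f (λ i → not (does (i ≟ a))) ≡ sum f - f a
  weight-except f a = begin
    sum (λ i → f i * ⟦ not (does (i ≟ a)) ⟧)   ≡⟨ sum-cong (λ i → trans (cong (f i *_)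
                                                   (⟦⟧-not (does (i ≟ a)))) (alg (f i) (δ a i))) ⟩
    sum (λ i → f i - δ a i * f i)              ≡⟨ sum-minus f (λ i → δ a i * f i) ⟩
    sum f - sum (λ i → δ a i * f i)            ≡⟨ cong (_-_ (sum f)) (sum-δ a f) ⟩
    sum f - f a                                ∎
    where
    open ≡-Reasoning
    alg : ∀ x y → x * (1ℤ - y) ≡ x - y * x
    alg = solve-∀

  weight-modular : ∀ (f : Fin n → ℤ) S S′ →
    weight f (λ i → S i ∧ S′ i) + weight f (λ i → S i ∨ S′ i) ≡ weight f S + weight f S′
  weight-modular f S S′ = begin
    weight f (λ i → S i ∧ S′ i) + weight f (λ i → S i ∨ S′ i)
      ≡⟨ sum-+ (λ i → f i * ⟦ S i ∧ S′ i ⟧) (λ i → f i * ⟦ S i ∨ S′ i ⟧) ⟨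
    sum (λ i → f i * ⟦ S i ∧ S′ i ⟧ + f i * ⟦ S i ∨ S′ i ⟧)
      ≡⟨ sum-cong pointwise ⟩
    sum (λ i → f i * ⟦ S i ⟧ + f i * ⟦ S′ i ⟧)
      ≡⟨ sum-+ (λ i → f i * ⟦ S i ⟧) (λ i → f i * ⟦ S′ i ⟧) ⟩
    weight f S + weight f S′
      ∎
    where
    open ≡-Reasoning
    alg : ∀ z x y → z * (x * y) + z * (x + y - x * y) ≡ z * x + z * y
    alg = solve-∀
    pointwise : ∀ i → f i * ⟦ S i ∧ S′ i ⟧ + f i * ⟦ S i ∨ S′ i ⟧ ≡ f i * ⟦ S i ⟧ + f i * ⟦ S′ i ⟧
    pointwise i rewrite ⟦⟧-∧ (S i) (S′ i) | ⟦⟧-∨ (S i) (S′ i) = alg (f i) ⟦ S i ⟧ ⟦ S′ i ⟧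

  -- Cuts, feasibility and submodularity

  Matrix : ℕ → ℕ → Set
  Matrix m n = Fin m → Fin n → Bool

  sum₂ : (Fin m → Fin n → ℤ) → ℤ
  sum₂ φ = sum (λ i → sum (φ i))

  sum₂-cong : {φ ψ : Fin m → Fin n → ℤ} → (∀ i j → φ i j ≡ ψ i j) → sum₂ φ ≡ sum₂ ψ
  sum₂-cong eq = sum-cong (λ i → sum-cong (eq i))

  sum₂-+ : (φ ψ : Fin m → Fin n → ℤ) → sum₂ (λ i j → φ i j + ψ i j) ≡ sum₂ φ + sum₂ ψ
  sum₂-+ φ ψ = trans (sum-cong (λ i → sum-+ (φ i) (ψ i))) (sum-+ (λ i → sum (φ i)) (λ i → sum (ψ i)))

  sum₂-mono : {φ ψ : Fin m → Fin n → ℤ} → (∀ i j → φ i j ≤ ψ i j) → sum₂ φ ≤ sum₂ ψ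
  sum₂-mono φ≤ψ = sum-mono (λ i → sum-mono (φ≤ψ i))

  sum₂-δ : ∀ (a : Fin m) (b : Fin n) (φ : Fin m → Fin n → ℤ) → sum₂ (λ i j → δ a i * δ b j * φ i j) ≡ φ a b
  sum₂-δ a b φ = begin
    sum₂ (λ i j → δ a i * δ b j * φ i j)             ≡⟨ sum₂-cong (λ i j → *-assoc (δ a i) (δ b j) (φ i j)) ⟩
    sum₂ (λ i j → δ a i * (δ b j * φ i j))           ≡⟨ sum-cong (λ i → sum-*ˡ (δ a i) (λ j → δ b j * φ i j)) ⟨
    sum (λ i → δ a i * sum (λ j → δ b j * φ i j))    ≡⟨ sum-cong (λ i → cong (δ a i *_) (sum-δ b (φ i))) ⟩
    sum (λ i → δ a i * φ i b)                        ≡⟨ sum-δ a (λ i → φ i b) ⟩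
    φ a b                                            ∎
    where open ≡-Reasoning

  crossing : Matrix m n → (Fin m → Bool) → (Fin n → Bool) → ℤ
  crossing E S U = sum₂ (λ i j → ⟦ E i j ⟧ * (⟦ S i ⟧ * (1ℤ - ⟦ U j ⟧)))

  -- The excess capacity of the cut (S , U) in the network that sends f i units into
  -- each row i and takes g j units out of each column j, with unit capacities on E.
  excess : Matrix m n → (Fin m → ℤ) → (Fin n → ℤ) → (Fin m → Bool) → (Fin n → Bool) → ℤ
  excess E f g S U = crossing E S U + weight g U - weight f S

  Feasible : Matrix m n → (Fin m → ℤ) → (Fin n → ℤ) → Set
  Feasible E f g = ∀ S U → 0ℤ ≤ excess E f g S U

  excess-cong : ∀ (E : Matrix m n) f g {S S′ U U′} → S ≗ S′ → U ≗ U′ →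
    excess E f g S U ≡ excess E f g S′ U′
  excess-cong E f g S≗S′ U≗U′ = cong₂ _-_
    (cong₂ _+_
      (sum₂-cong (λ i j → cong₂ (λ x y → ⟦ E i j ⟧ * (⟦ x ⟧ * (1ℤ - ⟦ y ⟧))) (S≗S′ i) (U≗U′ j)))
      (weight-cong g U≗U′))
    (weight-cong f S≗S′)

  -- The choice between discarding and selecting an edge needs a violating cut as data. There are
  -- finitely many cuts, so an exhaustive search decides.
  feasible? : ∀ (E : Matrix m n) f g → Feasible E f g ⊎ ∃₂ λ S U → excess E f g S U < 0ℤ
  feasible? E f g
    with anySubset? (λ S → anySubset? (λ U → excess E f g (lookup S) (lookup U) ℤ.<? 0ℤ))
  ... | yes (S , U , lt) = inj₂ (lookup S , lookup U , lt)
  ... | no none = inj₁ λ S U → ≮⇒≥ λ lt → none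
    (tabulate S , tabulate U ,
     subst (_< 0ℤ) (excess-cong E f g (sym ∘ lookup∘tabulate S) (sym ∘ lookup∘tabulate U)) lt)

  -- The deficit is known exactly: it counts the edges from `S − S′` to `U′ − U` and those from
  -- `S′ − S` to `U − U′`.
  crossing-submodular : ∀ (E : Matrix m n) S S′ U U′ →
    crossing E (λ i → S i ∧ S′ i) (λ j → U j ∧ U′ j) +
    crossing E (λ i → S i ∨ S′ i) (λ j → U j ∨ U′ j) ≤ crossing E S U + crossing E S′ U′
  crossing-submodular E S S′ U U′ = subst₂ _≤_
    (sum₂-+ (term (λ i → S i ∧ S′ i) (λ j → U j ∧ U′ j)) (term (λ i → S i ∨ S′ i) (λ j → U j ∨ U′ j)))
    (sum₂-+ (term S U) (term S′ U′))
    (sum₂-mono pointwise)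
    where
    term : (Fin _ → Bool) → (Fin _ → Bool) → Fin _ → Fin _ → ℤ
    term S U i j = ⟦ E i j ⟧ * (⟦ S i ⟧ * (1ℤ - ⟦ U j ⟧))
    alg : ∀ e s s′ u u′ →
      e * (s * (1ℤ - u)) + e * (s′ * (1ℤ - u′)) -
      (e * ((s * s′) * (1ℤ - u * u′)) + e * ((s + s′ - s * s′) * (1ℤ - (u + u′ - u * u′)))) ≡
      e * (s * (1ℤ - s′) * (u′ * (1ℤ - u)) + s′ * (1ℤ - s) * (u * (1ℤ - u′)))
    alg = solve-∀
    pointwise : ∀ i j →
      ⟦ E i j ⟧ * (⟦ S i ∧ S′ i ⟧ * (1ℤ - ⟦ U j ∧ U′ j ⟧)) +
      ⟦ E i j ⟧ * (⟦ S i ∨ S′ i ⟧ * (1ℤ - ⟦ U j ∨ U′ j ⟧)) ≤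
      ⟦ E i j ⟧ * (⟦ S i ⟧ * (1ℤ - ⟦ U j ⟧)) + ⟦ E i j ⟧ * (⟦ S′ i ⟧ * (1ℤ - ⟦ U′ j ⟧))
    pointwise i j
      rewrite ⟦⟧-∧ (S i) (S′ i) | ⟦⟧-∨ (S i) (S′ i) | ⟦⟧-∧ (U j) (U′ j) | ⟦⟧-∨ (U j) (U′ j) =
      certify
        (0≤* 0≤⟦ E i j ⟧ (0≤+
          (0≤* (0≤* 0≤⟦ S i ⟧ 0≤1-⟦ S′ i ⟧) (0≤* 0≤⟦ U′ j ⟧ 0≤1-⟦ U j ⟧))
          (0≤* (0≤* 0≤⟦ S′ i ⟧ 0≤1-⟦ S i ⟧) (0≤* 0≤⟦ U j ⟧ 0≤1-⟦ U′ j ⟧))))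
        (alg ⟦ E i j ⟧ ⟦ S i ⟧ ⟦ S′ i ⟧ ⟦ U j ⟧ ⟦ U′ j ⟧)

  excess-submodular : ∀ (E : Matrix m n) f g S S′ U U′ →
    excess E f g (λ i → S i ∧ S′ i) (λ j → U j ∧ U′ j) +
    excess E f g (λ i → S i ∨ S′ i) (λ j → U j ∨ U′ j) ≤ excess E f g S U + excess E f g S′ U′
  excess-submodular E f g S S′ U U′ = subst₂ _≤_
    (alg X∩ X∪ g∩ g∪ f∩ f∪)
    (trans (cong₂ (λ x y → crossing E S U + crossing E S′ U′ + x - y) (weight-modular g U U′) (weight-modular f S S′))
           (alg (crossing E S U) (crossing E S′ U′) (weight g U) (weight g U′) (weight f S) (weight f S′)))
    (+-monoˡ-≤ (- (f∩ + f∪)) (+-monoˡ-≤ (g∩ + g∪) (crossing-submodular E S S′ U U′)))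
    where
    S∩ = λ i → S i ∧ S′ i
    S∪ = λ i → S i ∨ S′ i
    U∩ = λ j → U j ∧ U′ j
    U∪ = λ j → U j ∨ U′ j
    X∩ = crossing E S∩ U∩
    X∪ = crossing E S∪ U∪
    f∩ = weight f S∩
    f∪ = weight f S∪
    g∩ = weight g U∩
    g∪ = weight g U∪
    alg : ∀ x x′ y y′ z z′ → x + x′ + (y + y′) - (z + z′) ≡ (x + y - z) + (x′ + y′ - z′)
    alg = solve-∀

  -- Discarding or selecting one edge

  only : Fin m → Fin n → Matrix m n
  only a b i j = does (i ≟ a) ∧ does (j ≟ b)

  _∖_ _∪_ : Matrix m n → Matrix m n → Matrix m n
  (E ∖ F) i j = E i j ∧ not (F i j)
  (E ∪ F) i j = E i j ∨ F i j

  split-edge : ∀ (E : Matrix m n) {a b} → T (E a b) → ∀ i j →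
    ⟦ E i j ⟧ ≡ ⟦ (E ∖ only a b) i j ⟧ + δ a i * δ b j
  split-edge E {a} {b} Eab i j with i ≟ a | j ≟ b
  ... | no _     | _     rewrite ∧-identityʳ (E i j) = sym (+-identityʳ _)
  ... | yes _    | no _ rewrite ∧-identityʳ (E i j) = sym (+-identityʳ _)
  ... | yes refl | yes refl with E i j
  ...   | true = refl

  crossing-remove : ∀ (E : Matrix m n) {a b} → T (E a b) → ∀ S U →
    crossing E S U ≡ crossing (E ∖ only a b) S U + ⟦ S a ⟧ * (1ℤ - ⟦ U b ⟧)
  crossing-remove E {a} {b} Eab S U = begin
    crossing E S U
      ≡⟨ sum₂-cong (λ i j → trans (cong (_* φ i j) (split-edge E Eab i j))
           (*-distribʳ-+ (φ i j) ⟦ (E ∖ only a b) i j ⟧ (δ a i * δ b j))) ⟩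
    sum₂ (λ i j → ⟦ (E ∖ only a b) i j ⟧ * φ i j + δ a i * δ b j * φ i j)
      ≡⟨ sum₂-+ (λ i j → ⟦ (E ∖ only a b) i j ⟧ * φ i j) (λ i j → δ a i * δ b j * φ i j) ⟩
    crossing (E ∖ only a b) S U + sum₂ (λ i j → δ a i * δ b j * φ i j)
      ≡⟨ cong (_+_ (crossing (E ∖ only a b) S U)) (sum₂-δ a b φ) ⟩
    crossing (E ∖ only a b) S U + φ a b
      ∎
    where
    open ≡-Reasoning
    φ : Fin _ → Fin _ → ℤ
    φ i j = ⟦ S i ⟧ * (1ℤ - ⟦ U j ⟧)

  excess-remove : ∀ (E : Matrix m n) f g {a b} → T (E a b) → ∀ S U →
    excess E f g S U ≡ excess (E ∖ only a b) f g S U + ⟦ S a ⟧ * (1ℤ - ⟦ U b ⟧)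
  excess-remove E f g {a} {b} Eab S U = trans
    (cong (λ x → x + weight g U - weight f S) (crossing-remove E Eab S U))
    (alg (crossing (E ∖ only a b) S U) (⟦ S a ⟧ * (1ℤ - ⟦ U b ⟧)) (weight g U) (weight f S))
    where
    alg : ∀ x y z w → x + y + z - w ≡ x + z - w + y
    alg = solve-∀

  excess-select : ∀ (E : Matrix m n) f g a b S U →
    excess E (λ i → f i - δ a i) (λ j → g j - δ b j) S U ≡ excess E f g S U - ⟦ U b ⟧ + ⟦ S a ⟧
  excess-select E f g a b S U = trans
    (cong₂ (λ x y → crossing E S U + x - y) (weight-minus-δ g b U) (weight-minus-δ f a S))
    (alg (crossing E S U) (weight g U) ⟦ U b ⟧ (weight f S) ⟦ S a ⟧)
    where
    alg : ∀ x y z u v → x + (y - z) - (u - v) ≡ x + y - u - z + v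
    alg = solve-∀

  opaque
    -- The first two hypotheses give `x + y ≥ u − s − 1`, while integrality turns the two strict
    -- ones into `z + w ≤ u − s − 2`. This misses `x + y ≤ z + w` by exactly 1.
    uncross : ∀ x y z w s u →
      0ℤ ≤ x + s * (1ℤ - 0ℤ) → 0ℤ ≤ y + 1ℤ * (1ℤ - u) → x + y ≤ z + w →
      z < 0ℤ → w - u + s < 0ℤ → ⊥
    uncross x y z w s u h₁ h₂ h₃ h₄ h₅ = 0≰-1
      (0≤+ (0≤+ (0≤+ h₁ h₂) (i≤j⇒0≤j-i {x + y} {z + w} h₃))
           (0≤+ (<⇒0≤ {z} {0ℤ} h₄) (<⇒0≤ {w - u + s} {0ℤ} h₅)))
      (alg x y z w s u)
      where
      alg : ∀ x y z w s u →
        (x + s * (1ℤ - 0ℤ)) + (y + 1ℤ * (1ℤ - u)) + (z + w - (x + y))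
        + ((0ℤ - z - 1ℤ) + (0ℤ - (w - u + s) - 1ℤ)) ≡ -1ℤ
      alg = solve-∀

  -- The bits tell whether the ends of the edge lie in the two cuts. Unless `s` is true and `u`
  -- false, the edge does not cross the first cut, so that cut was already violated before the
  -- removal. Only the remaining case needs submodularity.
  uncross-bits : ∀ s s′ u u′ x y z w →
    0ℤ ≤ z + ⟦ s ⟧ * (1ℤ - ⟦ u ⟧) →
    0ℤ ≤ x + ⟦ s ∧ s′ ⟧ * (1ℤ - ⟦ u ∧ u′ ⟧) → 0ℤ ≤ y + ⟦ s ∨ s′ ⟧ * (1ℤ - ⟦ u ∨ u′ ⟧) →
    x + y ≤ z + w → z < 0ℤ → w - ⟦ u′ ⟧ + ⟦ s′ ⟧ < 0ℤ → ⊥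
  uncross-bits false s′ u     u′ x y z w h₀ _ _ _ h₄ _ =
    <⇒≱ h₄ (subst (0ℤ ≤_) (trans (cong (_+_ z) (*-zeroˡ (1ℤ - ⟦ u ⟧))) (+-identityʳ z)) h₀)
  uncross-bits true  s′ true  u′ x y z w h₀ _ _ _ h₄ _ =
    <⇒≱ h₄ (subst (0ℤ ≤_) (trans (cong (_+_ z) (*-zeroʳ 1ℤ)) (+-identityʳ z)) h₀)
  uncross-bits true  s′ false u′ x y z w _ h₁ h₂ h₃ h₄ h₅ =
    uncross x y z w ⟦ s′ ⟧ ⟦ u′ ⟧ h₁ h₂ h₃ h₄ h₅

  -- Uncrossing: were (S , U) a witness against discarding the edge ab and (S′ , U′) one
  -- against selecting it, submodularity would produce an infeasible cut of E.
  no-two-violations : ∀ (E : Matrix m n) f g {a b} → T (E a b) → Feasible E f g → ∀ S U S′ U′ →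
    excess (E ∖ only a b) f g S U < 0ℤ →
    excess (E ∖ only a b) (λ i → f i - δ a i) (λ j → g j - δ b j) S′ U′ < 0ℤ → ⊥
  no-two-violations E f g {a} {b} Eab feas S U S′ U′ lt lt′ =
    uncross-bits (S a) (S′ a) (U b) (U′ b) (c S∩ U∩) (c S∪ U∪) (c S U) (c S′ U′)
      (feas⁻ S U) (feas⁻ S∩ U∩) (feas⁻ S∪ U∪)
      (excess-submodular E⁻ f g S S′ U U′) lt lt″
    where
    E⁻ = E ∖ only a b
    c = excess E⁻ f g

    feas⁻ : ∀ S U → 0ℤ ≤ c S U + ⟦ S a ⟧ * (1ℤ - ⟦ U b ⟧)
    feas⁻ S U = subst (0ℤ ≤_) (excess-remove E f g Eab S U) (feas S U)

    lt″ : c S′ U′ - ⟦ U′ b ⟧ + ⟦ S′ a ⟧ < 0ℤ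
    lt″ = subst (_< 0ℤ) (excess-select E⁻ f g a b S′ U′) lt′

    S∩ = λ i → S i ∧ S′ i
    S∪ = λ i → S i ∨ S′ i
    U∩ = λ j → U j ∧ U′ j
    U∪ = λ j → U j ∨ U′ j

  discard-or-select : ∀ (E : Matrix m n) f g {a b} → T (E a b) → Feasible E f g →
    Feasible (E ∖ only a b) f g ⊎
    Feasible (E ∖ only a b) (λ i → f i - δ a i) (λ j → g j - δ b j)
  discard-or-select E f g {a} {b} Eab feas = [ inj₁ , inj₂ ∘ select ]′ (feasible? (E ∖ only a b) f g)
    where
    select : (∃₂ λ S U → excess (E ∖ only a b) f g S U < 0ℤ) →
             Feasible (E ∖ only a b) (λ i → f i - δ a i) (λ j → g j - δ b j)
    select (S , U , lt) = [ id , (λ (S′ , U′ , lt′) → ⊥-elim (no-two-violations E f g Eab feas S U S′ U′ lt lt′)) ]′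
      (feasible? (E ∖ only a b) (λ i → f i - δ a i) (λ j → g j - δ b j))

  -- Subgraphs with prescribed degrees

  record Factor (E : Matrix m n) (f : Fin m → ℤ) (g : Fin n → ℤ) : Set where
    field
      selected : Matrix m n
      selected⊆ : ∀ i j → T (selected i j) → T (E i j)
      row-sum  : ∀ i → sum (λ j → ⟦ selected i j ⟧) ≡ f i
      col-sum  : ∀ j → sum (λ i → ⟦ selected i j ⟧) ≡ g j
  open Factor

  -- Without edges feasibility says `f(S) ≤ g(U)` for all `S` and `U`. Singletons and complements of
  -- singletons, with the equal totals, squeeze every demand to 0. Demands are integers, so
  -- selecting an edge may subtract freely on the way here; nonnegativity comes from feasibility.
  factor-empty : ∀ (E : Matrix m n) f g → (∀ i j → E i j ≡ false) →
    sum f ≡ sum g → Feasible E f g → Factor E f g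
  factor-empty E f g E≡∅ ∑f≡∑g feas = record
    { selected  = E
    ; selected⊆ = λ _ _ e → e
    ; row-sum   = λ i → trans (sum-zero (λ j → cong ⟦_⟧ (E≡∅ i j))) (f≡0 i)
    ; col-sum   = λ j → trans (sum-zero (λ i → cong ⟦_⟧ (E≡∅ i j))) (g≡0 j)
    }
    where
    crossing≡0 : ∀ S U → crossing E S U ≡ 0ℤ
    crossing≡0 S U = sum-zero (λ i → sum-zero (λ j → cong (λ x → ⟦ x ⟧ * (⟦ S i ⟧ * (1ℤ - ⟦ U j ⟧))) (E≡∅ i j)))

    feas′ : ∀ S U {x y} → weight g U ≡ x → weight f S ≡ y → y ≤ x
    feas′ S U refl refl = 0≤i-j⇒j≤i (subst (0ℤ ≤_)
      (cong (_- weight f S) (trans (cong (_+ weight g U) (crossing≡0 S U)) (+-identityˡ (weight g U))))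
      (feas S U))

    cancel : ∀ {x y} → x ≤ x - y → y ≤ 0ℤ
    cancel {x} {y} le = certify (i≤j⇒0≤j-i le) (alg x y)
      where
      alg : ∀ x y → 0ℤ - y ≡ x - y - x
      alg = solve-∀

    cancel′ : ∀ {x y} → x - y ≤ x → 0ℤ ≤ y
    cancel′ {x} {y} le = certify (i≤j⇒0≤j-i le) (alg x y)
      where
      alg : ∀ x y → y - 0ℤ ≡ x - (x - y)
      alg = solve-∀

    single : ∀ {k} (a : Fin k) φ → weight φ (λ i → does (i ≟ a)) ≡ φ a
    single a φ = trans (sum-cong (λ i → *-comm (φ i) (δ a i))) (sum-δ a φ)

    f≡0 : ∀ i → 0ℤ ≡ f i
    f≡0 i = ≤-antisym
      (cancel′ (feas′ (λ k → not (does (k ≟ i))) (λ _ → true)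
        (trans (weight-full g) (sym ∑f≡∑g)) (weight-except f i)))
      (feas′ (λ k → does (k ≟ i)) (λ _ → false) (weight-empty g) (single i f))

    g≡0 : ∀ j → 0ℤ ≡ g j
    g≡0 j = ≤-antisym
      (feas′ (λ _ → false) (λ k → does (k ≟ j)) (single j g) (weight-empty f))
      (cancel (feas′ (λ _ → true) (λ k → not (does (k ≟ j)))
        (weight-except g j) (trans (weight-full f) ∑f≡∑g)))

  ∖-⊆ : ∀ (E F : Matrix m n) i j → T ((E ∖ F) i j) → T (E i j)
  ∖-⊆ E F i j h with E i j
  ... | true = tt

  only-self : ∀ (a : Fin m) (b : Fin n) → only a b a b ≡ true
  only-self a b with a ≟ a | b ≟ b
  ... | yes _  | yes _  = refl
  ... | yes _  | no b≢b = ⊥-elim (b≢b refl)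
  ... | no a≢a | _      = ⊥-elim (a≢a refl)

  ∉-∖-only : ∀ (E : Matrix m n) a b → ¬ T ((E ∖ only a b) a b)
  ∉-∖-only E a b h with E a b | only a b a b | only-self a b
  ∉-∖-only E a b () | true  | true | refl
  ∉-∖-only E a b () | false | true | refl

  ∪-only-⊆ : ∀ (H E : Matrix m n) {a b} → T (E a b) → (∀ i j → T (H i j) → T (E i j)) →
    ∀ i j → T ((H ∪ only a b) i j) → T (E i j)
  ∪-only-⊆ H E {a} {b} Eab H⊆E i j h with H i j | H⊆E i j | i ≟ a | j ≟ b
  ... | true  | k | _        | _        = k tt
  ... | false | _ | yes refl | yes refl = Eab

  ∪-only-⟦⟧ : ∀ (H : Matrix m n) {a b} → ¬ T (H a b) → ∀ i j →
    ⟦ (H ∪ only a b) i j ⟧ ≡ ⟦ H i j ⟧ + δ a i * δ b j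
  ∪-only-⟦⟧ H {a} {b} Hab i j with i ≟ a | j ≟ b
  ... | no _     | _        = trans (cong ⟦_⟧ (∨-identityʳ (H i j))) (sym (+-identityʳ ⟦ H i j ⟧))
  ... | yes refl | no _     = trans (cong ⟦_⟧ (∨-identityʳ (H i j))) (sym (+-identityʳ ⟦ H i j ⟧))
  ... | yes refl | yes refl with H a b
  ...   | true  = ⊥-elim (Hab tt)
  ...   | false = refl

  Factor-discard : ∀ (E : Matrix m n) f g {a b} → Factor (E ∖ only a b) f g → Factor E f g
  Factor-discard E f g {a} {b} F = record
    { selected  = selected F
    ; selected⊆ = λ i j h → ∖-⊆ E (only a b) i j (selected⊆ F i j h)
    ; row-sum   = row-sum F
    ; col-sum   = col-sum F
    }

  Factor-select : ∀ (E : Matrix m n) f g {a b} → T (E a b) →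
    Factor (E ∖ only a b) (λ i → f i - δ a i) (λ j → g j - δ b j) → Factor E f g
  Factor-select E f g {a} {b} Eab F = record
    { selected  = selected F ∪ only a b
    ; selected⊆ = ∪-only-⊆ (selected F) E Eab (λ i j h → ∖-⊆ E (only a b) i j (selected⊆ F i j h))
    ; row-sum   = λ i → trans (sum-cong (split i))
        (trans (sum-+ (λ j → ⟦ selected F i j ⟧) (λ j → δ a i * δ b j))
        (trans (cong₂ _+_ (row-sum F i) (sum-δ-row i)) (alg (f i) (δ a i))))
    ; col-sum   = λ j → trans (sum-cong (λ i → split i j))
        (trans (sum-+ (λ i → ⟦ selected F i j ⟧) (λ i → δ a i * δ b j))
        (trans (cong₂ _+_ (col-sum F j) (sum-δ a (λ _ → δ b j))) (alg (g j) (δ b j))))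
    }
    where
    alg : ∀ x y → x - y + y ≡ x
    alg = solve-∀
    sum-δ-row : ∀ i → sum (λ j → δ a i * δ b j) ≡ δ a i
    sum-δ-row i = trans (sum-cong (λ j → *-comm (δ a i) (δ b j))) (sum-δ b (λ _ → δ a i))
    -- `F` lies in `E` without the edge `ab`, so adding `ab` raises the degrees of its two ends by
    -- exactly 1.
    split : ∀ i j → ⟦ (selected F ∪ only a b) i j ⟧ ≡ ⟦ selected F i j ⟧ + δ a i * δ b j
    split = ∪-only-⟦⟧ (selected F) (λ h → ∉-∖-only E a b (selected⊆ F a b h))

  -- `L` holds the pairs not yet decided. A decided edge leaves `E` in either case; if it was
  -- selected, the reduced demands remember it.
  factor-from : ∀ (L : List (Fin m × Fin n)) (E : Matrix m n) f g →
    (∀ i j → T (E i j) → (i , j) ∈ L) → sum f ≡ sum g → Feasible E f g → Factor E f g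
  factor-from [] E f g E⊆L ∑f≡∑g feas = factor-empty E f g (λ i j → absent (E⊆L i j)) ∑f≡∑g feas
    where
    absent : ∀ {x} {A : Set} {a : A} → (T x → a ∈ []) → x ≡ false
    absent {false} _ = refl
    absent {true}  h = case h tt of λ ()
  factor-from {m} {n} ((a , b) ∷ L) E f g E⊆L ∑f≡∑g feas = step (T? (E a b))
    where
    tail : ∀ (E′ : Matrix m n) → (∀ i j → T (E′ i j) → T (E i j)) → ¬ T (E′ a b) →
           ∀ i j → T (E′ i j) → (i , j) ∈ L
    tail E′ E′⊆E ab∉E′ i j h with E⊆L i j (E′⊆E i j h)
    ... | here refl = ⊥-elim (ab∉E′ h)
    ... | there q   = q

    E⁻⊆L : ∀ i j → T ((E ∖ only a b) i j) → (i , j) ∈ L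
    E⁻⊆L = tail (E ∖ only a b) (∖-⊆ E (only a b)) (∉-∖-only E a b)

    ∑≡ : sum (λ i → f i - δ a i) ≡ sum (λ j → g j - δ b j)
    ∑≡ = trans (sum-minus f (δ a)) (trans (cong₂ _-_ ∑f≡∑g (trans (sum-δ₁ a) (sym (sum-δ₁ b)))) (sym (sum-minus g (δ b))))

    step : Dec (T (E a b)) → Factor E f g
    step (no  ab∉E) = factor-from L E f g (tail E (λ _ _ h → h) ab∉E) ∑f≡∑g feas
    step (yes ab∈E) = [ (λ feas⁻ → Factor-discard E f g (factor-from L _ f g E⁻⊆L ∑f≡∑g feas⁻))
                      , (λ feas⁻ → Factor-select E f g ab∈E (factor-from L _ _ _ E⁻⊆L ∑≡ feas⁻))
                      ]′ (discard-or-select E f g ab∈E feas)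

  factor : ∀ (E : Matrix m n) f g → sum f ≡ sum g → Feasible E f g → Factor E f g
  factor {m} {n} E f g = factor-from (cartesianProduct (allFin m) (allFin n)) E f g
    (λ i j _ → ∈-cartesianProduct⁺ (∈-allFin i) (∈-allFin j))

  -- Regular subgraphs from the minimum degree

  opaque
    unfolding sum

    ∣tabulate∣ : ∀ (f : Fin n → Bool) → + Subset.∣ tabulate f ∣ ≡ sum (λ i → ⟦ f i ⟧)
    ∣tabulate∣ {ℕ.zero}  f = refl
    ∣tabulate∣ {ℕ.suc n} f with f zero
    ... | true  = cong (_+_ 1ℤ) (∣tabulate∣ (λ i → f (suc i)))
    ... | false = trans (∣tabulate∣ (λ i → f (suc i))) (sym (+-identityˡ (sum (λ i → ⟦ f (suc i) ⟧))))

  size : (Fin n → Bool) → ℤ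
  size S = sum (λ i → ⟦ S i ⟧)

  weight-const : ∀ r (S : Fin n → Bool) → weight (λ _ → r) S ≡ r * size S
  weight-const r S = sym (sum-*ˡ r (λ i → ⟦ S i ⟧))

  0≤size : ∀ (S : Fin n → Bool) → 0ℤ ≤ size S
  0≤size S = sum-nonNeg (λ i → 0≤⟦ S i ⟧)

  size-not : ∀ {n} (S : Fin n → Bool) → size (λ i → not (S i)) ≡ + n - size S
  size-not {n} S = begin
    sum (λ i → ⟦ not (S i) ⟧)       ≡⟨ sum-cong (λ i → ⟦⟧-not (S i)) ⟩
    sum (λ i → 1ℤ - ⟦ S i ⟧)        ≡⟨ sum-minus (λ _ → 1ℤ) (λ i → ⟦ S i ⟧) ⟩
    sum {n} (λ _ → 1ℤ) - size S     ≡⟨ cong (_- size S) (trans (sum-const n 1ℤ) (*-identityʳ (+ n))) ⟩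
    + n - size S                    ∎
    where open ≡-Reasoning

  size≤ : ∀ {n} (S : Fin n → Bool) → size S ≤ + n
  size≤ {n} S = 0≤i-j⇒j≤i (subst (0ℤ ≤_) (size-not S) (0≤size (λ i → not (S i))))

  _ᵀ : Matrix m n → Matrix n m
  (E ᵀ) j i = E i j

  -- Seen from the columns, the same edges lead from the complement of `U` to outside the complement
  -- of `S`. This makes the degree bound on columns available.
  crossing-ᵀ : ∀ (E : Matrix m n) S U →
    crossing E S U ≡ crossing (E ᵀ) (λ j → not (U j)) (λ i → not (S i))
  crossing-ᵀ E S U = trans (sum-comm (λ i j → ⟦ E i j ⟧ * (⟦ S i ⟧ * (1ℤ - ⟦ U j ⟧))))
    (sum₂-cong (λ j i → trans (alg ⟦ E i j ⟧ ⟦ S i ⟧ ⟦ U j ⟧)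
      (cong₂ (λ x y → ⟦ E i j ⟧ * (x * (1ℤ - y))) (sym (⟦⟧-not (U j))) (sym (⟦⟧-not (S i))))))
    where
    alg : ∀ e s u → e * (s * (1ℤ - u)) ≡ e * ((1ℤ - u) * (1ℤ - (1ℤ - s)))
    alg = solve-∀

  -- A row of `S` loses at most `size U` of its edges to `U`. The bound is used also when
  -- `d - size U` is negative.
  crossing-≥ : ∀ (E : Matrix m n) d → (∀ i → d ≤ sum (λ j → ⟦ E i j ⟧)) → ∀ S U →
    size S * (d - size U) ≤ crossing E S U
  crossing-≥ E d d≤deg S U = ≤-trans
    (subst (_≤ sum (λ i → ⟦ S i ⟧ * (deg i - size U))) outer (sum-mono by-row))
    (subst (_≤ crossing E S U) (sum-cong inner) (sum₂-mono by-entry))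
    where
    deg : Fin _ → ℤ
    deg i = sum (λ j → ⟦ E i j ⟧)

    outer : sum (λ i → ⟦ S i ⟧ * (d - size U)) ≡ size S * (d - size U)
    outer = trans (sum-cong (λ i → *-comm ⟦ S i ⟧ (d - size U)))
      (trans (sym (sum-*ˡ (d - size U) (λ i → ⟦ S i ⟧))) (*-comm (d - size U) (size S)))

    by-row : ∀ i → ⟦ S i ⟧ * (d - size U) ≤ ⟦ S i ⟧ * (deg i - size U)
    by-row i = *-monoˡ-≤-nonNeg ⟦ S i ⟧ {{nonNegative 0≤⟦ S i ⟧}} (+-monoˡ-≤ (- size U) (d≤deg i))

    inner : ∀ i → sum (λ j → ⟦ S i ⟧ * (⟦ E i j ⟧ - ⟦ U j ⟧)) ≡ ⟦ S i ⟧ * (deg i - size U)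
    inner i = trans (sym (sum-*ˡ ⟦ S i ⟧ (λ j → ⟦ E i j ⟧ - ⟦ U j ⟧)))
      (cong (⟦ S i ⟧ *_) (sum-minus (λ j → ⟦ E i j ⟧) (λ j → ⟦ U j ⟧)))

    alg : ∀ e s u → e * (s * (1ℤ - u)) - s * (e - u) ≡ s * (u * (1ℤ - e))
    alg = solve-∀

    by-entry : ∀ i j → ⟦ S i ⟧ * (⟦ E i j ⟧ - ⟦ U j ⟧) ≤ ⟦ E i j ⟧ * (⟦ S i ⟧ * (1ℤ - ⟦ U j ⟧))
    by-entry i j = certify (0≤* 0≤⟦ S i ⟧ (0≤* 0≤⟦ U j ⟧ 0≤1-⟦ E i j ⟧))
      (alg ⟦ E i j ⟧ ⟦ S i ⟧ ⟦ U j ⟧)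

  0≤square : ∀ x → 0ℤ ≤ x * x
  0≤square (+ n)    = 0≤* {+ n} {+ n} (+≤+ ℕ.z≤n) (+≤+ ℕ.z≤n)
  0≤square -[1+ n ] = +≤+ ℕ.z≤n

  opaque
    -- Integrality absorbs the rounding errors here: the slack `1` is all that may be lost after
    -- multiplying by 4.
    quarter-nonneg : ∀ z → 0ℤ ≤ + 4 * z + 1ℤ → 0ℤ ≤ z
    quarter-nonneg (+ n)    _  = +≤+ ℕ.z≤n
    quarter-nonneg -[1+ n ] h = ⊥-elim (0≰-1 (0≤+ h (+≤+ {0} {2 ℕ.+ 4 ℕ.* n} ℕ.z≤n)) eq)
      where
      eq′ : ∀ n → + 4 * (- (1ℤ + n)) + 1ℤ + (+ 2 + + 4 * n) ≡ -1ℤ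
      eq′ = solve-∀
      eq : + 4 * -[1+ n ] + 1ℤ + + (2 ℕ.+ 4 ℕ.* n) ≡ -1ℤ
      eq = trans (cong (λ x → + 4 * -[1+ n ] + 1ℤ + (+ 2 + x)) (pos-* 4 n)) (eq′ (+ n))

    -- With u = s − r and v = d − r − y the left-hand side is u v + r (d − r). For
    -- u ≥ 0 ≥ v, AM-GM bounds − 4 u v by (u − v)² ≤ (n − d)²; for u ≤ 0 ≤ v one has
    -- − u ≤ r and v ≤ d − r.
    cut-bound : ∀ n d r s y → 0ℤ ≤ r → 0ℤ ≤ d - r →
      (n - d) * (n - d) ≤ + 4 * (r * (d - r)) + 1ℤ →
      0ℤ ≤ s → 0ℤ ≤ y → y ≤ n - s → 0ℤ ≤ s * (d - y) + r * y - r * s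
    cut-bound n d r s y 0≤r r≤d h 0≤s 0≤y y≤n-s with ≤-total 0ℤ (s - r) | ≤-total 0ℤ (d - r - y)
    ... | inj₁ 0≤u | inj₁ 0≤v = subst (0ℤ ≤_) (alg d r s y) (0≤+ (0≤* 0≤u 0≤v) (0≤* 0≤r r≤d))
      where
      alg : ∀ d r s y → (s - r) * (d - r - y) + r * (d - r) ≡ s * (d - y) + r * y - r * s
      alg = solve-∀
    ... | inj₂ u≤0 | inj₂ v≤0 = subst (0ℤ ≤_) (alg d r s y)
        (0≤+ (0≤* (i≤j⇒0≤j-i u≤0) (i≤j⇒0≤j-i v≤0)) (0≤* 0≤r r≤d))
      where
      alg : ∀ d r s y → (0ℤ - (s - r)) * (0ℤ - (d - r - y)) + r * (d - r) ≡ s * (d - y) + r * y - r * s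
      alg = solve-∀
    ... | inj₂ u≤0 | inj₁ 0≤v = subst (0ℤ ≤_) (alg d r s y) (0≤+ (0≤* 0≤s 0≤v) (0≤* 0≤r 0≤y))
      where
      alg : ∀ d r s y → s * (d - r - y) + r * y ≡ s * (d - y) + r * y - r * s
      alg = solve-∀
    ... | inj₁ 0≤u | inj₂ v≤0 = quarter-nonneg (s * (d - y) + r * y - r * s)
        (subst (0ℤ ≤_) (alg n d r s y)
          (0≤+ (0≤+ (i≤j⇒0≤j-i h) (0≤square (s - r + (d - r - y))))
               (0≤* (0≤+ (0≤+ (0≤+ 0≤u (i≤j⇒0≤j-i v≤0)) (0≤+ 0≤u (i≤j⇒0≤j-i v≤0))) (i≤j⇒0≤j-i y≤n-s))
                    (i≤j⇒0≤j-i y≤n-s))))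
      where
      alg : ∀ n d r s y →
        (+ 4 * (r * (d - r)) + 1ℤ - (n - d) * (n - d)) + (s - r + (d - r - y)) * (s - r + (d - r - y))
        + ((s - r + (0ℤ - (d - r - y))) + (s - r + (0ℤ - (d - r - y))) + (n - s - y)) * (n - s - y)
        ≡ + 4 * (s * (d - y) + r * y - r * s) + 1ℤ
      alg = solve-∀

  module _ {n : ℕ} (G : Balanced n) (d : ℤ) (d≤degree : ∀ v → d ≤ + degree G v) (r : ℕ)
    (r≤d : 0ℤ ≤ d - + r) (bound : (+ n - d) * (+ n - d) ≤ + 4 * (+ r * (d - + r)) + 1ℤ) where

    private
      E = edge G

      via : ∀ S U s y → s * (d - y) ≤ crossing E S U → 0ℤ ≤ s → 0ℤ ≤ y → y ≤ + n - s →
        + r * y - + r * s ≡ + r * size U - + r * size S → 0ℤ ≤ excess E (λ _ → + r) (λ _ → + r) S U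
      via S U s y h 0≤s 0≤y y≤ eq = subst (0ℤ ≤_) eq′
        (≤-trans (cut-bound (+ n) d (+ r) s y (+≤+ ℕ.z≤n) r≤d bound 0≤s 0≤y y≤)
          (+-monoˡ-≤ (- (+ r * s)) (+-monoˡ-≤ (+ r * y) h)))
        where
        eq′ : crossing E S U + + r * y - + r * s ≡ excess E (λ _ → + r) (λ _ → + r) S U
        eq′ = trans (+-assoc (crossing E S U) (+ r * y) (- (+ r * s)))
          (trans (cong (_+_ (crossing E S U)) (trans eq (sym (cong₂ _-_ (weight-const (+ r) U) (weight-const (+ r) S)))))
            (sym (+-assoc (crossing E S U) (weight (λ _ → + r) U) (- weight (λ _ → + r) S))))

    regular-feasible : Feasible E (λ _ → + r) (λ _ → + r)
    -- `cut-bound` needs `s + y ≤ n`. If the sizes of `S` and `U` add up to more than `n`, those of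
    -- their complements add up to at most `n`, and the edges are counted from the columns.
    regular-feasible S U with ≤-total (size U) (+ n - size S)
    ... | inj₁ le = via S U (size S) (size U)
      (crossing-≥ E d (λ i → subst (d ≤_) (∣tabulate∣ (E i)) (d≤degree (inj₁ i))) S U)
      (0≤size S) (0≤size U) le refl
    ... | inj₂ ge = via S U (+ n - size U) (+ n - size S)
      (subst₂ _≤_ (cong₂ (λ x y → x * (d - y)) (size-not U) (size-not S)) (sym (crossing-ᵀ E S U))
        (crossing-≥ (E ᵀ) d (λ j → subst (d ≤_) (∣tabulate∣ (λ i → E i j)) (d≤degree (inj₂ j)))
          (λ j → not (U j)) (λ i → not (S i))))
      (i≤j⇒0≤j-i (size≤ U)) (i≤j⇒0≤j-i (size≤ S)) (subst (_ ≤_) (alg₁ (+ n) (size U)) ge)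
      (alg₂ (+ n) (+ r) (size S) (size U))
      where
      alg₁ : ∀ n u → u ≡ n - (n - u)
      alg₁ = solve-∀
      alg₂ : ∀ n r s u → r * (n - s) - r * (n - u) ≡ r * u - r * s
      alg₂ = solve-∀

    regular-spanning : HasRegularSpanningSubgraph r G
    regular-spanning = record { edge = selected F } , selected⊆ F , λ
      { (inj₁ i) → +-injective (trans (∣tabulate∣ (selected F i)) (row-sum F i))
      ; (inj₂ j) → +-injective (trans (∣tabulate∣ (λ i → selected F i j)) (col-sum F j))
      }
      where
      F = factor E (λ _ → + r) (λ _ → + r) refl regular-feasible

  ∈-vertices : ∀ (v : Vertex {m} {n}) → v ∈ vertices
  ∈-vertices (inj₁ i) = ∈-++⁺ˡ (∈-map⁺ inj₁ (∈-allFin i))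
  ∈-vertices {m} (inj₂ j) = ∈-++⁺ʳ (map inj₁ (allFin m)) (∈-map⁺ inj₂ (∈-allFin j))

  minDegree≤degree : ∀ .{{_ : ℕ.NonZero m}} (G : BipartiteGraph m n) v → minDegree G ℕ.≤ degree G v
  minDegree≤degree {ℕ.suc m} G v = min≤v⁺ (degree G (inj₁ zero)) (map (degree G) vertices)
    (inj₂ (Any.map (λ {refl → ℕ.≤-refl}) (∈-map⁺ (degree G) (∈-vertices v))))

  ≤minDegree : ∀ .{{_ : ℕ.NonZero m}} (G : BipartiteGraph m n) {d} →
    (∀ v → d ℕ.≤ degree G v) → d ℕ.≤ minDegree G
  ≤minDegree {ℕ.suc m} G {d} h = v≤min⁺ (h (inj₁ zero)) (All.map⁺ (All.universal h vertices))

  -- The extremal graph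

  low : ℕ → Fin n → Bool
  low x i = toℕ i ℕ.<ᵇ x

  opaque
    unfolding sum

    size-low : ∀ {n} x → x ℕ.≤ n → size {n} (low x) ≡ + x
    size-low {ℕ.zero}  ℕ.zero    x≤n         = refl
    size-low {ℕ.suc n} ℕ.zero    x≤n         = trans (+-identityˡ (size {n} (low 0))) (size-low {n} 0 ℕ.z≤n)
    size-low {ℕ.suc n} (ℕ.suc x) (ℕ.s≤s x≤n) = cong (_+_ 1ℤ) (size-low {n} x x≤n)

  sum-*ʳ : ∀ (f : Fin n → ℤ) x → sum (λ i → f i * x) ≡ sum f * x
  sum-*ʳ f x = trans (sum-cong (λ i → *-comm (f i) x)) (trans (sym (sum-*ˡ x f)) (*-comm x (sum f)))

  ⟦⟧-mono : ∀ {x y} → (T x → T y) → ⟦ x ⟧ ≤ ⟦ y ⟧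
  ⟦⟧-mono {false} {y}     _ = 0≤⟦ y ⟧
  ⟦⟧-mono {true}  {true}  _ = ≤-refl
  ⟦⟧-mono {true}  {false} h = ⊥-elim (h tt)

  opaque
    -- This is the cut condition for a `k`-regular subgraph of the complete bipartite graph with
    -- classes of size `s`, where the cut has `σ` rows and `υ` columns.
    block-bound : ∀ s k σ υ → 0ℤ ≤ k → 0ℤ ≤ s - k → 0ℤ ≤ σ → 0ℤ ≤ s - σ → 0ℤ ≤ υ → 0ℤ ≤ s - υ →
      0ℤ ≤ σ * (s - υ) + k * υ - k * σ
    block-bound s k σ υ 0≤k k≤s 0≤σ σ≤s 0≤υ υ≤s with ≤-total σ υ
    ... | inj₁ σ≤υ = subst (0ℤ ≤_) (alg s k σ υ) (0≤+ (0≤* 0≤σ υ≤s) (0≤* 0≤k (i≤j⇒0≤j-i σ≤υ)))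
      where
      alg : ∀ s k σ υ → σ * (s - υ) + k * (υ - σ) ≡ σ * (s - υ) + k * υ - k * σ
      alg = solve-∀
    ... | inj₂ υ≤σ = subst (0ℤ ≤_) (alg s k σ υ) (0≤+ (0≤* k≤s (i≤j⇒0≤j-i υ≤σ)) (0≤* 0≤υ σ≤s))
      where
      alg : ∀ s k σ υ → (s - k) * (σ - υ) + υ * (s - σ) ≡ σ * (s - υ) + k * υ - k * σ
      alg = solve-∀

  module Extremal (n d x : ℕ) (x≤d : x ℕ.≤ d) (d≤n : d ℕ.≤ n) where

    private
      a : Fin n → ℤ
      a i = ⟦ low x i ⟧

      k s : ℤ
      k = + d - + x
      s = + n - + x

      0≤k : 0ℤ ≤ k
      0≤k = i≤j⇒0≤j-i (+≤+ x≤d)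

      k≤s : 0ℤ ≤ s - k
      k≤s = subst (0ℤ ≤_) (alg (+ n) (+ d) (+ x)) (i≤j⇒0≤j-i (+≤+ d≤n))
        where
        alg : ∀ n d x → n - d ≡ n - x - (d - x)
        alg = solve-∀

      sum-a : sum a ≡ + x
      sum-a = size-low x (ℕ.≤-trans x≤d d≤n)

      b : Fin n → ℤ
      b i = 1ℤ - a i

      0≤b : ∀ i → 0ℤ ≤ b i
      0≤b i = 0≤1-⟦ low x i ⟧

      sum-b : sum b ≡ s
      sum-b = trans (sum-minus (λ _ → 1ℤ) a)
        (cong₂ _-_ (trans (sum-const n 1ℤ) (*-identityʳ (+ n))) sum-a)

    block : Matrix n n
    block i j = not (low x i) ∧ not (low x j)

    -- The demand vanishes at the `x` joined vertices, so the regular graph on the others is found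
    -- as a factor on all of `Fin n`, without reindexing.
    demand : Fin n → ℤ
    demand i = k * b i

    block-feasible : Feasible block demand demand
    block-feasible S U = subst (0ℤ ≤_) (sym eq)
      (block-bound s k (part S) (part U) 0≤k k≤s (0≤part S) (part≤s S) (0≤part U) (part≤s U))
      where
      part : (Fin n → Bool) → ℤ
      part S = sum (λ i → b i * ⟦ S i ⟧)

      0≤part : ∀ S → 0ℤ ≤ part S
      0≤part S = sum-nonNeg (λ i → 0≤* (0≤b i) 0≤⟦ S i ⟧)

      part-complement : ∀ S → sum (λ i → b i * (1ℤ - ⟦ S i ⟧)) ≡ s - part S
      part-complement S = trans (sum-cong (λ i → alg (b i) ⟦ S i ⟧))
        (trans (sum-minus b (λ i → b i * ⟦ S i ⟧)) (cong (_- part S) sum-b))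
        where
        alg : ∀ x y → x * (1ℤ - y) ≡ x - x * y
        alg = solve-∀

      part≤s : ∀ S → 0ℤ ≤ s - part S
      part≤s S = subst (0ℤ ≤_) (part-complement S) (sum-nonNeg (λ i → 0≤* (0≤b i) 0≤1-⟦ S i ⟧))

      weight-demand : ∀ S → weight demand S ≡ k * part S
      weight-demand S = trans (sum-cong (λ i → *-assoc k (b i) ⟦ S i ⟧)) (sym (sum-*ˡ k (λ i → b i * ⟦ S i ⟧)))

      crossing-block : crossing block S U ≡ part S * (s - part U)
      crossing-block = begin
        crossing block S U
          ≡⟨ sum₂-cong (λ i j → trans (cong (_* (⟦ S i ⟧ * (1ℤ - ⟦ U j ⟧)))
               (trans (⟦⟧-∧ (not (low x i)) (not (low x j))) (cong₂ _*_ (⟦⟧-not (low x i)) (⟦⟧-not (low x j)))))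
               (alg (b i) (b j) ⟦ S i ⟧ ⟦ U j ⟧)) ⟩
        sum₂ (λ i j → b i * ⟦ S i ⟧ * (b j * (1ℤ - ⟦ U j ⟧)))
          ≡⟨ sum-cong (λ i → sum-*ˡ (b i * ⟦ S i ⟧) (λ j → b j * (1ℤ - ⟦ U j ⟧))) ⟨
        sum (λ i → b i * ⟦ S i ⟧ * sum (λ j → b j * (1ℤ - ⟦ U j ⟧)))
          ≡⟨ sum-*ʳ (λ i → b i * ⟦ S i ⟧) (sum (λ j → b j * (1ℤ - ⟦ U j ⟧))) ⟩
        part S * sum (λ j → b j * (1ℤ - ⟦ U j ⟧))
          ≡⟨ cong (part S *_) (part-complement U) ⟩
        part S * (s - part U) ∎
        where
        open ≡-Reasoning
        alg : ∀ p q s u → p * q * (s * (1ℤ - u)) ≡ p * s * (q * (1ℤ - u))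
        alg = solve-∀

      eq : excess block demand demand S U ≡ part S * (s - part U) + k * part U - k * part S
      eq = cong₂ _-_ (cong₂ _+_ crossing-block (weight-demand U)) (weight-demand S)

    core : Factor block demand demand
    core = factor block demand demand refl block-feasible

    open Factor core using ()
      renaming (selected to inner; selected⊆ to inner⊆; row-sum to inner-row; col-sum to inner-col)

    graph : Balanced n
    graph = record { edge = λ i j → (low x i ∨ low x j) ∨ inner i j }

    private
      entry : ∀ x y z → (T z → T (not x ∧ not y)) →
        ⟦ (x ∨ y) ∨ z ⟧ ≡ ⟦ x ⟧ + (1ℤ - ⟦ x ⟧) * ⟦ y ⟧ + ⟦ z ⟧
      entry false false z     _ = sym (+-identityˡ ⟦ z ⟧)
      entry false true  false _ = refl
      entry true  _     false _ = refl
      entry false true  true  h = ⊥-elim (h tt)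
      entry true  _     true  h = ⊥-elim (h tt)

      line-sum : ∀ i (h : Fin n → ℤ) → sum h ≡ demand i →
        sum (λ j → a i + b i * a j + h j) ≡ + d + a i * (+ n - + d)
      line-sum i h eq = begin
        sum (λ j → a i + b i * a j + h j)
          ≡⟨ sum-+ (λ j → a i + b i * a j) h ⟩
        sum (λ j → a i + b i * a j) + sum h
          ≡⟨ cong₂ _+_ (sum-+ (λ _ → a i) (λ j → b i * a j)) eq ⟩
        sum {n} (λ _ → a i) + sum (λ j → b i * a j) + k * b i
          ≡⟨ cong (_+ k * b i) (cong₂ _+_ (sum-const n (a i))
               (trans (sym (sum-*ˡ (b i) a)) (cong (b i *_) sum-a))) ⟩
        + n * a i + b i * + x + k * b i
          ≡⟨ alg (+ n) (+ d) (+ x) (a i) ⟩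
        + d + a i * (+ n - + d)
          ∎
        where
        open ≡-Reasoning
        alg : ∀ n d x a → n * a + (1ℤ - a) * x + (d - x) * (1ℤ - a) ≡ d + a * (n - d)
        alg = solve-∀

    row-degree : ∀ i → + degree graph (inj₁ i) ≡ + d + a i * (+ n - + d)
    row-degree i = trans (∣tabulate∣ (λ j → edge graph i j))
      (trans (sum-cong (λ j → entry (low x i) (low x j) (inner i j) (inner⊆ i j)))
        (line-sum i (λ j → ⟦ inner i j ⟧) (inner-row i)))

    col-degree : ∀ j → + degree graph (inj₂ j) ≡ + d + a j * (+ n - + d)
    col-degree j = trans (∣tabulate∣ (λ i → edge graph i j))
      (trans (sum-cong (λ i → trans (entry (low x i) (low x j) (inner i j) (inner⊆ i j))
               (alg (a i) (a j) ⟦ inner i j ⟧)))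
        (line-sum j (λ i → ⟦ inner i j ⟧) (inner-col j)))
      where
      alg : ∀ x y z → x + (1ℤ - x) * y + z ≡ y + (1ℤ - y) * x + z
      alg = solve-∀

    d≤degree : ∀ v → d ℕ.≤ degree graph v
    d≤degree v = drop‿+≤+ (bound v)
      where
      above : ∀ i → + d ≤ + d + a i * (+ n - + d)
      above i = subst (_≤ + d + a i * (+ n - + d)) (+-identityʳ (+ d))
        (+-monoʳ-≤ (+ d) (0≤* 0≤⟦ low x i ⟧ (i≤j⇒0≤j-i (+≤+ d≤n))))
      bound : ∀ v → + d ≤ + degree graph v
      bound (inj₁ i) = subst (+ d ≤_) (sym (row-degree i)) (above i)
      bound (inj₂ j) = subst (+ d ≤_) (sym (col-degree j)) (above j)

    degree-attained : ∀ i → low x i ≡ false → degree graph (inj₁ i) ≡ d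
    degree-attained i eq = +-injective (trans (row-degree i)
      (trans (cong (λ y → + d + ⟦ y ⟧ * (+ n - + d)) eq) (+-identityʳ (+ d))))

    -- The `s` remaining rows carry `r * s` edges of the subgraph. Each ends in one of the `x`
    -- joined columns, which take `x * r` edges in all, or is one of the `k * s` edges of `inner`.
    regular-bound : ∀ r → HasRegularSpanningSubgraph r graph →
      + r * s ≤ + x * + r + k * s
    regular-bound r (H , H⊆G , regular) = subst₂ _≤_ left right (sum₂-mono by-entry)
      where
      h : Fin n → Fin n → ℤ
      h i j = ⟦ edge H i j ⟧

      by-bit : ∀ x y h z → (T h → T ((x ∨ y) ∨ z)) → (1ℤ - ⟦ x ⟧) * ⟦ h ⟧ ≤ ⟦ y ⟧ * ⟦ h ⟧ + ⟦ z ⟧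
      by-bit true  y     h     z _ = 0≤+ {⟦ y ⟧ * ⟦ h ⟧} {⟦ z ⟧} (0≤* 0≤⟦ y ⟧ 0≤⟦ h ⟧) 0≤⟦ z ⟧
      by-bit false true  h     z _ = certify {1ℤ * ⟦ h ⟧} {1ℤ * ⟦ h ⟧ + ⟦ z ⟧} 0≤⟦ z ⟧ (alg ⟦ h ⟧ ⟦ z ⟧)
        where
        alg : ∀ h z → 1ℤ * h + z - 1ℤ * h ≡ z
        alg = solve-∀
      by-bit false false h     z k = subst₂ _≤_ (sym (*-identityˡ ⟦ h ⟧)) (sym (+-identityˡ ⟦ z ⟧)) (⟦⟧-mono k)

      by-entry : ∀ i j → b i * h i j ≤ a j * h i j + ⟦ inner i j ⟧
      by-entry i j = by-bit (low x i) (low x j) (edge H i j) (inner i j) (H⊆G i j)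

      row : ∀ i → sum (h i) ≡ + r
      row i = trans (sym (∣tabulate∣ (edge H i))) (cong +_ (regular (inj₁ i)))

      col : ∀ j → sum (λ i → h i j) ≡ + r
      col j = trans (sym (∣tabulate∣ (λ i → edge H i j))) (cong +_ (regular (inj₂ j)))

      left : sum₂ (λ i j → b i * h i j) ≡ + r * s
      left = trans (sum-cong (λ i → trans (sym (sum-*ˡ (b i) (h i))) (cong (b i *_) (row i))))
        (trans (sum-*ʳ b (+ r)) (trans (cong (_* + r) sum-b) (*-comm s (+ r))))

      right : sum₂ (λ i j → a j * h i j + ⟦ inner i j ⟧) ≡ + x * + r + k * s
      right = trans (sum₂-+ (λ i j → a j * h i j) (λ i j → ⟦ inner i j ⟧)) (cong₂ _+_
        (trans (sum-comm (λ i j → a j * h i j))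
          (trans (sum-cong (λ j → trans (sym (sum-*ˡ (a j) (λ i → h i j))) (cong (a j *_) (col j))))
            (trans (sum-*ʳ a (+ r)) (cong (_* + r) sum-a))))
        (trans (sum-cong inner-row) (trans (sym (sum-*ˡ k b)) (cong (k *_) sum-b))))

  -- The choice of `x`

  opaque
    -- The last hypothesis amounts to `r (n − 2x) ≤ (n − x)(d − x)`. As `n − 2x` is positive, its
    -- failure at `r₀` passes to all larger `r`; it is applied with `r₀ = 1 + c`.
    regular-impossible : ∀ n d x r r₀ → 0ℤ < n - + 2 * x → r₀ ≤ r →
      (n - x) * (d - x) < r₀ * (n - + 2 * x) → r * (n - x) ≤ x * r + (d - x) * (n - x) → ⊥
    regular-impossible n d x r r₀ pos r₀≤r lt le = 0≰-1
      (0≤+ (0≤+ (<⇒0≤ {(n - x) * (d - x)} {r₀ * (n - + 2 * x)} lt)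
                (i≤j⇒0≤j-i {r * (n - x)} {x * r + (d - x) * (n - x)} le))
           (0≤* {r - r₀} {n - + 2 * x} (i≤j⇒0≤j-i r₀≤r) (<⇒≤ pos)))
      (alg n d x r r₀)
      where
      alg : ∀ n d x r r₀ → r₀ * (n - + 2 * x) - (n - x) * (d - x) - 1ℤ
        + (x * r + (d - x) * (n - x) - r * (n - x)) + (r - r₀) * (n - + 2 * x) ≡ -1ℤ
      alg = solve-∀

  -- The parity bit `ε` is described by inequalities, ready for use in certificates.
  halve : ∀ m → ∃₂ λ x ε → + m ≡ ε + + 2 * + x × 0ℤ ≤ ε × 0ℤ ≤ 1ℤ - ε * ε
  halve ℕ.zero = 0 , 0ℤ , refl , ≤-refl , +≤+ ℕ.z≤n
  halve (ℕ.suc ℕ.zero) = 0 , 1ℤ , refl , +≤+ ℕ.z≤n , ≤-refl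
  halve (ℕ.suc (ℕ.suc m)) with halve m
  ... | x , ε , eq , h = ℕ.suc x , ε , trans (cong (_+_ (+ 2)) eq) (alg ε (+ x)) , h
    where
    alg : ∀ ε x → + 2 + (ε + + 2 * x) ≡ ε + + 2 * (1ℤ + x)
    alg = solve-∀

  opaque
    -- With `w = 2c − d`, four times `(1 + c)(n − 2x) − (n − x)(d − x)` equals
    -- `w² − n(2d − n) + 4w + 4 − ε²`. The `4` pays for strictness, and the parity loss `ε²` is
    -- covered by the slack in `quarter-nonneg`.
    centre-bounds : ∀ n d c x ε → n ≡ ε + + 2 * x - d + + 2 * (1ℤ + c) →
      0ℤ ≤ + 2 * d - n → 0ℤ ≤ + 2 * c - d → n * (+ 2 * d - n) ≤ (+ 2 * c - d) * (+ 2 * c - d) →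
      0ℤ ≤ ε → 0ℤ ≤ 1ℤ - ε * ε →
      0ℤ ≤ d - x × 0ℤ ≤ n - + 2 * x - 1ℤ ×
      0ℤ ≤ (1ℤ + c) * (n - + 2 * x) - (n - x) * (d - x) - 1ℤ
    centre-bounds n d c x ε refl n≤2d d≤2c h 0≤ε ε≤1 =
      quarter-nonneg (d - x) (subst (0ℤ ≤_) (alg₁ d c x ε)
        (0≤+ (0≤+ (0≤+ n≤2d n≤2d) (0≤+ d≤2c d≤2c)) (0≤+ (0≤+ 0≤ε 0≤ε) (+≤+ {0} {5} ℕ.z≤n)))) ,
      subst (0ℤ ≤_) (alg₂ d c x ε) (0≤+ (0≤+ 0≤ε d≤2c) (+≤+ {0} {1} ℕ.z≤n)) ,
      quarter-nonneg _ (subst (0ℤ ≤_) (alg₃ d c x ε)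
        (0≤+ (0≤+ (i≤j⇒0≤j-i h) (0≤* (+≤+ {0} {4} ℕ.z≤n) d≤2c)) ε≤1))
      where
      alg₁ : ∀ d c x ε → let n = ε + + 2 * x - d + + 2 * (1ℤ + c) in
        (+ 2 * d - n + (+ 2 * d - n)) + ((+ 2 * c - d) + (+ 2 * c - d)) + ((ε + ε) + + 5)
        ≡ + 4 * (d - x) + 1ℤ
      alg₁ = solve-∀
      alg₂ : ∀ d c x ε → let n = ε + + 2 * x - d + + 2 * (1ℤ + c) in
        ε + (+ 2 * c - d) + 1ℤ ≡ n - + 2 * x - 1ℤ
      alg₂ = solve-∀
      alg₃ : ∀ d c x ε → let n = ε + + 2 * x - d + + 2 * (1ℤ + c) in
        (+ 2 * c - d) * (+ 2 * c - d) - n * (+ 2 * d - n) + + 4 * (+ 2 * c - d) + (1ℤ - ε * ε)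
        ≡ + 4 * ((1ℤ + c) * (n - + 2 * x) - (n - x) * (d - x) - 1ℤ) + 1ℤ
      alg₃ = solve-∀

  0≤⇒< : ∀ {x y} → 0ℤ ≤ y - x - 1ℤ → x < y
  0≤⇒< {x} {y} h = suc[i]≤j⇒i<j (certify h (alg x y))
    where
    alg : ∀ x y → y - (1ℤ + x) ≡ y - x - 1ℤ
    alg = solve-∀

  -- The hypotheses say c ≥ (d + √(n (2d − n))) / 2. If 1 + c ≤ d, the cut deficiency of
  -- the extremal graph is largest at x = (n + d) / 2 − (1 + c), rounded down.
  opaque
    extremal-parameter : ∀ n d c → 0 ℕ.< n → d ℕ.≤ n → 0ℤ ≤ + 2 * + d - + n →
      0ℤ ≤ + 2 * c - + d → + n * (+ 2 * + d - + n) ≤ (+ 2 * c - + d) * (+ 2 * c - + d) →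
      ∃ λ x → x ℕ.≤ d × 0ℤ < + n - + 2 * + x ×
        (+ n - + x) * (+ d - + x) < (1ℤ + c) * (+ n - + 2 * + x)
    extremal-parameter n d c 0<n d≤n n≤2d d≤2c h with 1ℤ + c ℤ.≤? + d
    -- Here `1 + c > d`, and at `x = 0` the inequality reads `n d < (1 + c) n`: the extremal graph
    -- is then itself `d`-regular.
    ... | no ≰ = 0 , ℕ.z≤n , subst (0ℤ <_) (alg₀ (+ n)) (+<+ 0<n) ,
        0≤⇒< {(+ n - 0ℤ) * (+ d - 0ℤ)} (subst (0ℤ ≤_) (alg (+ n) (+ d) c)
          (0≤+ (<⇒0≤ (+<+ 0<n)) (0≤* (+≤+ {0} {n} ℕ.z≤n) (<⇒0≤ (≰⇒> ≰)))))
      where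
      alg₀ : ∀ n → n ≡ n - + 2 * 0ℤ
      alg₀ = solve-∀
      alg : ∀ n d c → n - 0ℤ - 1ℤ + n * (1ℤ + c - d - 1ℤ) ≡
        (1ℤ + c) * (n - + 2 * 0ℤ) - (n - 0ℤ) * (d - 0ℤ) - 1ℤ
      alg = solve-∀
    ... | yes 1+c≤d = from-halves (halve ∣ M ∣)
      where
      M : ℤ
      M = + n + + d - + 2 * (1ℤ + c)
      0≤M : 0ℤ ≤ M
      0≤M = subst (0ℤ ≤_) (alg (+ n) (+ d) c)
        (0≤+ (i≤j⇒0≤j-i (+≤+ d≤n)) (0≤+ (i≤j⇒0≤j-i 1+c≤d) (i≤j⇒0≤j-i 1+c≤d)))
        where
        alg : ∀ n d c → n - d + (d - (1ℤ + c) + (d - (1ℤ + c))) ≡ n + d - + 2 * (1ℤ + c)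
        alg = solve-∀
      alg : ∀ n d c → n ≡ n + d - + 2 * (1ℤ + c) - d + + 2 * (1ℤ + c)
      alg = solve-∀
      from-halves : (∃₂ λ x ε → + ∣ M ∣ ≡ ε + + 2 * + x × 0ℤ ≤ ε × 0ℤ ≤ 1ℤ - ε * ε) →
        ∃ λ x → x ℕ.≤ d × 0ℤ < + n - + 2 * + x ×
          (+ n - + x) * (+ d - + x) < (1ℤ + c) * (+ n - + 2 * + x)
      from-halves (x , ε , eq , 0≤ε , ε≤1) =
        let h₁ , h₂ , h₃ = centre-bounds (+ n) (+ d) c (+ x) ε
              (trans (alg (+ n) (+ d) c) (cong (λ m → m - + d + + 2 * (1ℤ + c)) (trans (sym (0≤i⇒+∣i∣≡i 0≤M)) eq)))
              n≤2d d≤2c h 0≤ε ε≤1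
        in x , drop‿+≤+ (0≤i-j⇒j≤i h₁)
         , 0≤⇒< (subst (λ y → 0ℤ ≤ y - 1ℤ) (sym (+-identityʳ (+ n - + 2 * + x))) h₂)
         , 0≤⇒< {(+ n - + x) * (+ d - + x)} h₃

  extremal-graph : ∀ n .{{_ : ℕ.NonZero n}} d c → d ℕ.≤ n → 0ℤ ≤ + 2 * + d - + n →
    0ℤ ≤ + 2 * c - + d → + n * (+ 2 * + d - + n) ≤ (+ 2 * c - + d) * (+ 2 * c - + d) →
    ∃ λ (G : Balanced n) → minDegree G ≡ d × (∀ r → + r > c → ¬ HasRegularSpanningSubgraph r G)
  extremal-graph n@(ℕ.suc n′) d c d≤n n≤2d d≤2c h with extremal-parameter n d c (ℕ.s≤s ℕ.z≤n) d≤n n≤2d d≤2c h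
  ... | x , x≤d , pos , lt = graph ,
      ℕ.≤-antisym
        (subst (minDegree graph ℕ.≤_) (degree-attained top (top-high))
          (minDegree≤degree graph (inj₁ top)))
        (≤minDegree graph d≤degree) ,
      λ r r>c reg → regular-impossible (+ n) (+ d) (+ x) (+ r) (1ℤ + c) pos
        (i<j⇒suc[i]≤j r>c) lt (regular-bound r reg)
    where
    open Extremal n d x x≤d d≤n
    -- Since `2x < n`, the last row is not among the joined ones and has degree exactly `d`.
    top : Fin n
    top = fromℕ n′

    x≤n′ : x ℕ.≤ n′
    x≤n′ = ℕ.s≤s⁻¹ (drop‿+<+ {x} {n} (0≤⇒< {+ x} {+ n} (subst (0ℤ ≤_) (alg (+ n) (+ x))
             (0≤+ (<⇒0≤ pos) (+≤+ {0} {x} ℕ.z≤n)))))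
      where
      alg : ∀ n x → n - + 2 * x - 0ℤ - 1ℤ + x ≡ n - x - 1ℤ
      alg = solve-∀

    top-high : low x top ≡ false
    top-high = trans (cong (ℕ._<ᵇ x) (toℕ-fromℕ n′)) (≥⇒<ᵇ x n′ x≤n′)
      where
      ≥⇒<ᵇ : ∀ x m → x ℕ.≤ m → (m ℕ.<ᵇ x) ≡ false
      ≥⇒<ᵇ ℕ.zero    m         _          = refl
      ≥⇒<ᵇ (ℕ.suc x) (ℕ.suc m) (ℕ.s≤s le) = ≥⇒<ᵇ x m le

-- Rational points of the cut of `δ + √(2δ − 1)`

module RationalRoots where

  open import Data.Empty using (⊥-elim)
  open import Data.Integer.Base as ℤ using (ℤ; +_)
  import Data.Integer.Properties as ℤ
  open import Data.Nat.Base as ℕ using (ℕ; suc)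
  import Data.Nat.Properties as ℕ
  open import Data.Product.Base using (_×_; _,_)
  open import Data.Rational.Base
  open import Data.Rational.Properties as ℚ using ()
  open import Data.Rational.Solver using (module +-*-Solver)
  import Data.Rational.Unnormalised.Base as ℚᵘ
  import Data.Rational.Unnormalised.Properties as ℚᵘ
  open import Data.Sum.Base using (_⊎_; inj₁; inj₂)
  open import Function.Base using (case_of_)
  open import Relation.Binary.PropositionalEquality
  open import Relation.Nullary using (yes; no; ¬_)

  <⇒0< : ∀ {p q} → p < q → 0ℚ < q - p
  <⇒0< {p} {q} p<q = subst (_< q - p) (ℚ.+-inverseʳ p) (ℚ.+-monoˡ-< (- p) p<q)

  0<⇒< : ∀ {p q} → 0ℚ < q - p → p < q
  0<⇒< {p} {q} 0<q-p = subst₂ _<_ (ℚ.+-identityˡ p) (cancel p q) (ℚ.+-monoˡ-< p 0<q-p)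
    where
    open +-*-Solver
    cancel : ∀ p q → q - p + p ≡ q
    cancel = solve 2 (λ p q → q :- p :+ p := q) refl

  ≤⇒0≤ : ∀ {p q} → p ≤ q → 0ℚ ≤ q - p
  ≤⇒0≤ {p} {q} p≤q = subst (_≤ q - p) (ℚ.+-inverseʳ p) (ℚ.+-monoˡ-≤ (- p) p≤q)

  0<* : ∀ {p q} → 0ℚ < p → 0ℚ < q → 0ℚ < p * q
  0<* {p} {q} 0<p 0<q = subst (_< p * q) (ℚ.*-zeroˡ q) (ℚ.*-monoˡ-<-pos q {{positive 0<q}} 0<p)

  0≤* : ∀ {p q} → 0ℚ ≤ p → 0ℚ ≤ q → 0ℚ ≤ p * q
  0≤* {p} {q} 0≤p 0≤q = subst (_≤ p * q) (ℚ.*-zeroˡ q) (ℚ.*-monoʳ-≤-nonNeg q {{nonNegative 0≤q}} 0≤p)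

  0<1 : 0ℚ < 1ℚ
  0<1 = ℚ.positive⁻¹ 1ℚ

  *-cancel-< : ∀ {p q} r → 0ℚ < r → p * r < q * r → p < q
  *-cancel-< r 0<r = ℚ.*-cancelʳ-<-nonNeg r {{nonNegative (ℚ.<⇒≤ 0<r)}}

  ÷-* : ∀ a c .{{_ : NonZero c}} → (a ÷ c) * c ≡ a
  ÷-* a c = trans (ℚ.*-assoc a (1/ c) c) (trans (cong (a *_) (ℚ.*-inverseˡ c)) (ℚ.*-identityʳ a))

  -- One step of the secant method for t² = D with a second point K > √D.
  module Secant (c D : ℚ) (0≤c : 0ℚ ≤ c) (0≤D : 0ℚ ≤ D) where
    open +-*-Solver

    private
      K L : ℚ
      K = 1ℚ + D
      L = c + K

      0<K : 0ℚ < K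
      0<K = ℚ.<-≤-trans 0<1 (subst (_≤ K) (ℚ.+-identityʳ 1ℚ) (ℚ.+-monoʳ-≤ 1ℚ 0≤D))

      0<L : 0ℚ < L
      0<L = ℚ.<-≤-trans 0<K (subst (_≤ L) (ℚ.+-identityˡ K) (ℚ.+-monoˡ-≤ K 0≤c))

      instance
        L≢0 : NonZero L
        L≢0 = ℚ.pos⇒nonZero L {{positive 0<L}}

      0<L² : 0ℚ < L * L
      0<L² = 0<* 0<L 0<L

      -- For `K = 1 + D` this quantity is `K² − D`. By `step-square` its sign keeps `next` on the
      -- same side of the root as `c`.
      0<gap : 0ℚ < K + D * D
      0<gap = ℚ.<-≤-trans 0<K (subst (_≤ K + D * D) (ℚ.+-identityʳ K) (ℚ.+-monoʳ-≤ K (0≤* 0≤D 0≤D)))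

    opaque
      next : ℚ
      next = (c * K + D) ÷ L

      next-L : next * L ≡ c * K + D
      next-L = ÷-* (c * K + D) L

    private
      step : ∀ c D → let K = 1ℚ + D in c * K + D - c * (c + K) ≡ D - c * c
      step = solve 2 (λ c D → let K = con 1ℚ :+ D in c :* K :+ D :- c :* (c :+ K) := D :- c :* c) refl

      step-square : ∀ c D → let K = 1ℚ + D; L = c + K; M = c * K + D in
        D * (L * L) - M * M ≡ (D - c * c) * (K + D * D)
      step-square = solve 2 (λ c D → let K = con 1ℚ :+ D; L = c :+ K; M = c :* K :+ D in
        D :* (L :* L) :- M :* M := (D :- c :* c) :* (K :+ D :* D)) refl

      next-square : next * next * (L * L) ≡ (c * K + D) * (c * K + D)
      next-square = trans (swap next L) (cong (λ x → x * x) next-L)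
        where
        swap : ∀ x y → x * x * (y * y) ≡ (x * y) * (x * y)
        swap = solve 2 (λ x y → x :* x :* (y :* y) := (x :* y) :* (x :* y)) refl

      flip : ∀ x y → - (x - y) ≡ y - x
      flip = solve 2 (λ x y → :- (x :- y) := y :- x) refl

    -- The cuts of `√_` ask for a rational strictly between the tested point and the root. `next` is
    -- such a rational from below, and in `decreases` from above.
    increases : c * c < D → c < next × next * next < D
    increases c²<D =
      *-cancel-< L 0<L (subst (c * L <_) (sym next-L) (0<⇒< (subst (0ℚ <_) (sym (step c D)) (<⇒0< c²<D)))) ,
      *-cancel-< (L * L) 0<L² (subst (_< D * (L * L)) (sym next-square)
        (0<⇒< (subst (0ℚ <_) (sym (step-square c D)) (0<* (<⇒0< c²<D) 0<gap))))

    decreases : 0ℚ < c → D < c * c → 0ℚ < next × next < c × D < next * next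
    decreases 0<c D<c² =
      *-cancel-< L 0<L (subst₂ _<_ (sym (ℚ.*-zeroˡ L)) (sym next-L) 0<cK+D) ,
      *-cancel-< L 0<L (subst (_< c * L) (sym next-L)
        (0<⇒< (subst (0ℚ <_)
          (trans (sym (flip D (c * c))) (trans (cong -_ (sym (step c D))) (flip (c * K + D) (c * L))))
          (<⇒0< D<c²)))) ,
      *-cancel-< (L * L) 0<L² (subst (D * (L * L) <_) (sym next-square)
        (0<⇒< (subst (0ℚ <_)
          (trans (neg* D (c * c) (K + D * D)) (trans (cong -_ (sym (step-square c D)))
            (flip (D * (L * L)) ((c * K + D) * (c * K + D)))))
          (0<* (<⇒0< D<c²) 0<gap))))
      where
      0<cK+D : 0ℚ < c * K + D
      0<cK+D = ℚ.<-≤-trans (0<* 0<c 0<K) (subst (_≤ c * K + D) (ℚ.+-identityʳ (c * K)) (ℚ.+-monoʳ-≤ (c * K) 0≤D))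
      neg* : ∀ x y z → (y - x) * z ≡ - ((x - y) * z)
      neg* = solve 3 (λ x y z → (y :- x) :* z := :- ((x :- y) :* z)) refl

  2ℚ : ℚ
  2ℚ = + 2 / 1

  *-÷ : ∀ a c .{{_ : NonZero c}} → (a * c) ÷ c ≡ a
  *-÷ a c = trans (ℚ.*-assoc a c (1/ c)) (trans (cong (a *_) (ℚ.*-inverseʳ c)) (ℚ.*-identityʳ a))

  ÷-<ˡ : ∀ {a b} c .{{_ : NonZero c}} → 0ℚ < c → a < b * c → a ÷ c < b
  ÷-<ˡ {a} {b} c 0<c a<bc = *-cancel-< c 0<c (subst (_< b * c) (sym (÷-* a c)) a<bc)

  ÷-<ʳ : ∀ {a b} c .{{_ : NonZero c}} → 0ℚ < c → b * c < a → b < a ÷ c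
  ÷-<ʳ {a} {b} c 0<c bc<a = *-cancel-< c 0<c (subst (b * c <_) (sym (÷-* a c)) bc<a)

  -- In (II) `δ` is an arbitrary cut, known only through `n ·ℕ δ` being an integer. These two
  -- implications let it be treated like the rational cut of (I).
  record Represents (δ : ℝ) (β : ℚ) : Set where
    field
      below : ∀ {a} → a < β → lower δ a
      above : ∀ {a} → β < a → upper δ a

  module _ {δ : ℝ} {β : ℚ} (rep : Represents δ β) where
    open Represents rep

    lower⇒< : ∀ {a} → lower δ a → a < β
    lower⇒< {a} la with a ℚ.<? β
    ... | yes a<β = a<β
    ... | no  a≮β = let a′ , a<a′ , la′ = lower-open δ la in
      ⊥-elim (disjoint δ la′ (above (ℚ.≤-<-trans (ℚ.≮⇒≥ a≮β) a<a′)))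

    private
      open +-*-Solver

      radicand : ℝ
      radicand = 2 ·ℕ δ +ℝ fromℚ (- 1ℚ)

      0<2 : 0ℚ < 2ℚ
      0<2 = ℚ.positive⁻¹ 2ℚ

      transfer : ∀ {p q p′ q′} → p < q → q - p ≡ q′ - p′ → p′ < q′
      transfer p<q eq = 0<⇒< (subst (0ℚ <_) eq (<⇒0< p<q))

      lower-radicand : ∀ {t} → t < β * 2ℚ - 1ℚ → lower radicand t
      lower-radicand {t} t<D =
        case ℚ.<-dense {t + 1ℚ} {β * 2ℚ} (transfer t<D (eq₁ β t {2ℚ} {1ℚ})) of λ (a , t+1<a , a<2β) →
        case ℚ.<-dense {t - a} { - 1ℚ} (transfer t+1<a (eq₂ a t {1ℚ})) of λ (b , t-a<b , b<-1) →
        a , b , below (÷-<ˡ 2ℚ 0<2 a<2β) , b<-1 , transfer t-a<b (eq₃ a b t)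
        where
        eq₁ : ∀ β t {z u} → β * z - u - t ≡ β * z - (t + u)
        eq₁ β t {z} {u} = solve 4 (λ β t z u → β :* z :- u :- t := β :* z :- (t :+ u)) refl β t z u
        eq₂ : ∀ a t {u} → a - (t + u) ≡ - u - (t - a)
        eq₂ a t {u} = solve 3 (λ a t u → a :- (t :+ u) := :- u :- (t :- a)) refl a t u
        eq₃ : ∀ a b t → b - (t - a) ≡ a + b - t
        eq₃ = solve 3 (λ a b t → b :- (t :- a) := a :+ b :- t) refl

      upper-radicand : ∀ {t} → β * 2ℚ - 1ℚ < t → upper radicand t
      upper-radicand {t} D<t =
        case ℚ.<-dense {β * 2ℚ} {t + 1ℚ} (transfer D<t (eq₁ β t {2ℚ} {1ℚ})) of λ (a , 2β<a , a<t+1) →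
        case ℚ.<-dense { - 1ℚ} {t - a} (transfer a<t+1 (eq₂ a t {1ℚ})) of λ (b , -1<b , b<t-a) →
        a , b , above (÷-<ʳ 2ℚ 0<2 2β<a) , -1<b , transfer b<t-a (eq₃ a b t)
        where
        eq₁ : ∀ β t {z u} → t - (β * z - u) ≡ t + u - β * z
        eq₁ β t {z} {u} = solve 4 (λ β t z u → t :- (β :* z :- u) := t :+ u :- β :* z) refl β t z u
        eq₂ : ∀ a t {u} → t + u - a ≡ t - a - (- u)
        eq₂ a t {u} = solve 3 (λ a t u → t :+ u :- a := t :- a :- (:- u)) refl a t u
        eq₃ : ∀ a b t → t - a - b ≡ t - (a + b)
        eq₃ = solve 3 (λ a b t → t :- a :- b := t :- (a :+ b)) refl

    -- Every negative rational lies in the lower cut of a square root, so the radicand need not be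
    -- examined.
    lower-root-below : ∀ {p} → p < β → lower (δ +ℝ √ radicand) p
    lower-root-below {p} p<β =
      case ℚ.<-dense p<β of λ (m , p<m , m<β) →
      case ℚ.<-dense m<β of λ (a , m<a , a<β) →
      a , m - a , below a<β , inj₁ (transfer m<a (eq₁ a m)) , transfer p<m (eq₂ a m p)
      where
      eq₁ : ∀ a m → a - m ≡ 0ℚ - (m - a)
      eq₁ = solve 2 (λ a m → a :- m := con 0ℚ :- (m :- a)) refl
      eq₂ : ∀ a m p → m - p ≡ a + (m - a) - p
      eq₂ = solve 3 (λ a m p → m :- p := a :+ (m :- a) :- p) refl

    -- The secant step from `p - β` leaves room below the root; this room is shared so that both
    -- summands lie strictly inside their lower cuts and still exceed `p` together.
    lower-root : ∀ {p} → β ≤ p → (p - β) * (p - β) < β * 2ℚ - 1ℚ → lower (δ +ℝ √ radicand) p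
    lower-root {p} β≤p c²<D =
      case increases c²<D of λ (c<next , next²<D) →
      case ℚ.<-dense c<next of λ (m , c<m , m<next) →
      case ℚ.<-dense {p - m} {β} (transfer c<m (eq₁ β m p)) of λ (a , p-m<a , a<β) →
      a , m , below a<β
       , inj₂ (next , ℚ.<⇒≤ (ℚ.≤-<-trans 0≤c c<next) , m<next , lower-radicand next²<D)
       , transfer p-m<a (eq₂ a m p)
      where
      0≤c : 0ℚ ≤ p - β
      0≤c = ≤⇒0≤ β≤p
      open Secant (p - β) (β * 2ℚ - 1ℚ) 0≤c (ℚ.≤-trans (0≤* 0≤c 0≤c) (ℚ.<⇒≤ c²<D))
      eq₁ : ∀ β m p → m - (p - β) ≡ β - (p - m)
      eq₁ = solve 3 (λ β m p → m :- (p :- β) := β :- (p :- m)) refl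
      eq₂ : ∀ a m p → a - (p - m) ≡ a + m - p
      eq₂ = solve 3 (λ a m p → a :- (p :- m) := a :+ m :- p) refl

    upper-root : ∀ {p} → 0ℚ ≤ β * 2ℚ - 1ℚ → β < p → β * 2ℚ - 1ℚ < (p - β) * (p - β) →
      upper (δ +ℝ √ radicand) p
    upper-root {p} 0≤D β<p D<c² =
      case decreases (<⇒0< β<p) D<c² of λ (0<next , next<c , D<next²) →
      case ℚ.<-dense next<c of λ (m , next<m , m<c) →
      case ℚ.<-dense {β} {p - m} (transfer m<c (eq₁ β m p)) of λ (a , β<a , a<p-m) →
      a , m , above β<a , (next , 0<next , next<m , upper-radicand D<next²) , transfer a<p-m (eq₂ a m p)
      where
      open Secant (p - β) (β * 2ℚ - 1ℚ) (ℚ.<⇒≤ (<⇒0< β<p)) 0≤D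
      eq₁ : ∀ β m p → p - β - m ≡ p - m - β
      eq₁ = solve 3 (λ β m p → p :- β :- m := p :- m :- β) refl
      eq₂ : ∀ a m p → p - m - a ≡ p - (a + m)
      eq₂ = solve 3 (λ a m p → p :- m :- a := p :- (a :+ m)) refl

  -- `_≤ℝ_` speaks of lower cuts only. Openness of the upper cut of `y` makes room to apply
  -- locatedness of `x`.
  ≤ℝ-upper : ∀ {x y} → x ≤ℝ y → ∀ {q} → upper y q → upper x q
  ≤ℝ-upper {x} {y} x≤y {q} uq with upper-open y uq
  ... | q′ , q′<q , uq′ with located x q′<q
  ...   | inj₁ lq′ = ⊥-elim (disjoint y (x≤y q′ lq′) uq′)
  ...   | inj₂ uxq = uxq

  -- Comparing integers with `n ρ₀`

  emb : ℤ → ℚ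
  emb z = z / 1

  private
    toℚᵘ-emb : ∀ z → toℚᵘ (emb z) ℚᵘ.≃ ℚᵘ.mkℚᵘ z 0
    toℚᵘ-emb z = ℚ.toℚᵘ-fromℚᵘ (ℚᵘ.mkℚᵘ z 0)

  emb-+ : ∀ a b → emb (a ℤ.+ b) ≡ emb a + emb b
  emb-+ a b = ℚ.toℚᵘ-injective (ℚᵘ.≃-trans (toℚᵘ-emb (a ℤ.+ b)) (ℚᵘ.≃-trans
    (ℚᵘ.*≡* (cong (ℤ._* ℤ.1ℤ) (sym (cong₂ ℤ._+_ (ℤ.*-identityʳ a) (ℤ.*-identityʳ b)))))
    (ℚᵘ.≃-sym (ℚᵘ.≃-trans (ℚ.toℚᵘ-homo-+ (emb a) (emb b)) (ℚᵘ.+-cong (toℚᵘ-emb a) (toℚᵘ-emb b))))))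

  emb-* : ∀ a b → emb (a ℤ.* b) ≡ emb a * emb b
  emb-* a b = ℚ.toℚᵘ-injective (ℚᵘ.≃-trans (toℚᵘ-emb (a ℤ.* b))
    (ℚᵘ.≃-sym (ℚᵘ.≃-trans (ℚ.toℚᵘ-homo-* (emb a) (emb b)) (ℚᵘ.*-cong (toℚᵘ-emb a) (toℚᵘ-emb b)))))

  emb-minus : ∀ a b → emb (a ℤ.- b) ≡ emb a - emb b
  emb-minus a b = begin
    emb (a ℤ.- b)                     ≡⟨ alg (emb (a ℤ.- b)) (emb b) ⟩
    emb (a ℤ.- b) + emb b - emb b     ≡⟨ cong (_- emb b) (emb-+ (a ℤ.- b) b) ⟨
    emb (a ℤ.- b ℤ.+ b) - emb b       ≡⟨ cong (λ z → emb z - emb b) (trans (ℤ.+-assoc a (ℤ.- b) b)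
                                           (trans (cong (ℤ._+_ a) (ℤ.+-inverseˡ b)) (ℤ.+-identityʳ a))) ⟩
    emb a - emb b                     ∎
    where
    open ≡-Reasoning
    open +-*-Solver
    alg : ∀ x y → x ≡ x + y - y
    alg = solve 2 (λ x y → x := x :+ y :- y) refl

  emb-mono-< : ∀ {a b} → a ℤ.< b → emb a < emb b
  emb-mono-< {a} {b} a<b = ℚ.toℚᵘ-cancel-< (ℚᵘ.<-respˡ-≃ (ℚᵘ.≃-sym (toℚᵘ-emb a))
    (ℚᵘ.<-respʳ-≃ (ℚᵘ.≃-sym (toℚᵘ-emb b))
      (ℚᵘ.*<* (subst₂ ℤ._<_ (sym (ℤ.*-identityʳ a)) (sym (ℤ.*-identityʳ b)) a<b))))

  emb-mono-≤ : ∀ {a b} → a ℤ.≤ b → emb a ≤ emb b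
  emb-mono-≤ {a} {b} a≤b with a ℤ.≟ b
  ... | yes refl = ℚ.≤-refl
  ... | no  a≢b  = ℚ.<⇒≤ (emb-mono-< (ℤ.≤∧≢⇒< a≤b a≢b))

  emb-cancel-≤ : ∀ {a b} → emb a ≤ emb b → a ℤ.≤ b
  emb-cancel-≤ {a} {b} le = ℤ.≮⇒≥ λ b<a → ℚ.<-irrefl refl (ℚ.<-≤-trans (emb-mono-< b<a) le)

  /-*-emb : ∀ z n .{{_ : ℕ.NonZero n}} → (z / n) * emb (+ n) ≡ emb z
  /-*-emb z n@(suc n-1) = ℚ.toℚᵘ-injective (ℚᵘ.≃-trans
    (ℚᵘ.≃-trans (ℚ.toℚᵘ-homo-* (z / n) (emb (+ n))) (ℚᵘ.*-cong (ℚ.toℚᵘ-fromℚᵘ (ℚᵘ.mkℚᵘ z n-1)) (toℚᵘ-emb (+ n))))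
    (ℚᵘ.≃-trans (ℚᵘ.*≡* eq) (ℚᵘ.≃-sym (toℚᵘ-emb z))))
    where
    eq : z ℤ.* + n ℤ.* ℤ.1ℤ ≡ z ℤ.* + suc (n-1 ℕ.* 1)
    eq = trans (ℤ.*-identityʳ (z ℤ.* + n)) (cong (λ k → z ℤ.* + suc k) (sym (ℕ.*-identityʳ n-1)))

  module Scaled (n : ℕ) .{{_ : ℕ.NonZero n}} (d : ℤ) {δ : ℝ} (rep : Represents δ (d / n)) where

    private
      open +-*-Solver

      N β d̂ Δ̂ : ℚ
      N = emb (+ n)
      β = d / n
      d̂ = emb d
      Δ̂ = N * (2ℚ * d̂ - N)

      X : ℝ
      X = n ·ℕ ρ₀ δ

      0<2 : 0ℚ < 2ℚ
      0<2 = ℚ.positive⁻¹ 2ℚ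

      instance
        N>0 : Positive N
        N>0 = ℚ.normalize-pos n 1

        N≢0 : NonZero N
        N≢0 = ℚ.pos⇒nonZero N

      0<N : 0ℚ < N
      0<N = ℚ.positive⁻¹ N

      ω : ℚ → ℚ
      ω q = 2ℚ * q - d̂

      ω-mono-< : ∀ {q r} → q < r → ω q < ω r
      ω-mono-< q<r = ℚ.+-monoˡ-< (- d̂) (ℚ.*-monoʳ-<-pos 2ℚ q<r)

      -- The two scalings in `n ·ℕ ρ₀ δ` send a test of `q` to a test of `δ + √(2δ − 1)` at this
      -- point, that is, at `2q / n`.
      point : ℚ → ℚ
      point q = (q ÷ N) ÷ ½

      opaque
        point-ω : ∀ q → (point q - β) * N ≡ ω q
        point-ω q = begin
          (point q - β) * N                   ≡⟨ alg₁ (point q) β N ⟩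
          2ℚ * (point q * ½ * N) - β * N      ≡⟨ cong₂ (λ x y → 2ℚ * x - y)
                                                   (trans (cong (_* N) (÷-* (q ÷ N) ½)) (÷-* q N)) (/-*-emb d n) ⟩
          2ℚ * q - d̂                          ∎
          where
          open ≡-Reasoning
          alg₁ : ∀ p β N → (p - β) * N ≡ 2ℚ * (p * ½ * N) - β * N
          alg₁ = solve 3 (λ p β N → (p :- β) :* N := con 2ℚ :* (p :* con ½ :* N) :- β :* N) refl

        point-Δ : (β * 2ℚ - 1ℚ) * (N * N) ≡ Δ̂
        point-Δ = trans (alg₁ β N) (cong (λ x → N * (2ℚ * x - N)) (/-*-emb d n))
          where
          alg₁ : ∀ β N → (β * 2ℚ - 1ℚ) * (N * N) ≡ N * (2ℚ * (β * N) - N)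
          alg₁ = solve 2 (λ β N → (β :* con 2ℚ :- con 1ℚ) :* (N :* N) := N :* (con 2ℚ :* (β :* N) :- N)) refl

        point-square : ∀ q → (point q - β) * (point q - β) * (N * N) ≡ ω q * ω q
        point-square q = trans (alg₁ (point q - β) N) (cong (λ x → x * x) (point-ω q))
          where
          alg₁ : ∀ x N → x * x * (N * N) ≡ (x * N) * (x * N)
          alg₁ = solve 2 (λ x N → x :* x :* (N :* N) := (x :* N) :* (x :* N)) refl

      0<N² : 0ℚ < N * N
      0<N² = 0<* 0<N 0<N

      point< : ∀ q → ω q < 0ℚ → point q < β
      point< q ω<0 = 0<⇒< (subst (0ℚ <_) (alg (point q) β) (ℚ.neg-antimono-< (*-cancel-< {point q - β} {0ℚ} N 0<N
        (subst₂ _<_ (sym (point-ω q)) (sym (ℚ.*-zeroˡ N)) ω<0))))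
        where
        alg : ∀ p β → - (p - β) ≡ β - p
        alg = solve 2 (λ p β → :- (p :- β) := β :- p) refl

      point> : ∀ q → 0ℚ < ω q → β < point q
      point> q 0<ω = 0<⇒< (*-cancel-< {0ℚ} {point q - β} N 0<N
        (subst₂ _<_ (sym (ℚ.*-zeroˡ N)) (sym (point-ω q)) 0<ω))

      point≥ : ∀ q → ¬ ω q < 0ℚ → β ≤ point q
      point≥ q ω≮0 = ℚ.≮⇒≥ λ p<β → ω≮0 (subst₂ _<_ (point-ω q) (ℚ.*-zeroˡ N)
        (ℚ.*-monoˡ-<-pos N (subst (point q - β <_) (ℚ.+-inverseʳ β) (ℚ.+-monoˡ-< (- β) p<β))))

      lower-X-below : ∀ q → ω q < 0ℚ → lower X q
      lower-X-below q ω<0 = lower-root-below rep (point< q ω<0)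

      lower-X : ∀ q → ω q * ω q < Δ̂ → lower X q
      lower-X q lt = case ω q ℚ.<? 0ℚ of λ
        { (yes ω<0) → lower-X-below q ω<0
        ; (no  ω≮0) → lower-root rep (point≥ q ω≮0)
            (*-cancel-< (N * N) 0<N² (subst₂ _<_ (sym (point-square q)) (sym point-Δ) lt))
        }

      upper-X : ∀ q → 0ℚ ≤ Δ̂ → 0ℚ < ω q → Δ̂ < ω q * ω q → upper X q
      upper-X q 0≤Δ 0<ω lt = upper-root rep
        (ℚ.*-cancelʳ-≤-pos (N * N) {{positive 0<N²}} (subst₂ _≤_ (sym (ℚ.*-zeroˡ (N * N))) (sym point-Δ) 0≤Δ))
        (point> q 0<ω)
        (*-cancel-< (N * N) 0<N² (subst₂ _<_ (sym point-Δ) (sym (point-square q)) lt))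

    w : ℤ → ℤ
    w z = + 2 ℤ.* z ℤ.- d

    Δ : ℤ
    Δ = + n ℤ.* (+ 2 ℤ.* d ℤ.- + n)

    private
      emb-w : ∀ z → emb (w z) ≡ ω (emb z)
      emb-w z = trans (emb-minus (+ 2 ℤ.* z) d) (cong (_- d̂) (emb-* (+ 2) z))

      emb-w² : ∀ z → emb (w z ℤ.* w z) ≡ ω (emb z) * ω (emb z)
      emb-w² z = trans (emb-* (w z) (w z)) (cong (λ x → x * x) (emb-w z))

      emb-Δ : emb Δ ≡ Δ̂
      emb-Δ = trans (emb-* (+ n) (+ 2 ℤ.* d ℤ.- + n))
        (cong (N *_) (trans (emb-minus (+ 2 ℤ.* d) (+ n)) (cong (_- N) (emb-* (+ 2) d))))

      0≤Δ̂ : ℤ.0ℤ ℤ.≤ Δ → 0ℚ ≤ Δ̂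
      0≤Δ̂ 0≤Δ = subst (0ℚ ≤_) emb-Δ (emb-mono-≤ 0≤Δ)

    -- Only rationals strictly below `z` are tested, and there the weak inequality for `w z` becomes
    -- the strict one that an open cut demands.
    ≤-multiple : ∀ z → w z ℤ.≤ ℤ.0ℤ ⊎ w z ℤ.* w z ℤ.≤ Δ → fromℤ z ≤ℝ n ·ℕ ρ₀ δ
    ≤-multiple z (inj₁ w≤0) q q<z = lower-X-below q
      (ℚ.<-≤-trans (ω-mono-< q<z) (subst (_≤ 0ℚ) (emb-w z) (emb-mono-≤ w≤0)))
    ≤-multiple z (inj₂ w²≤Δ) q q<z = case ω q ℚ.<? 0ℚ of λ
      { (yes ω<0) → lower-X-below q ω<0
      ; (no  ω≮0) → lower-X q (ℚ.<-≤-trans (square-mono (ℚ.≮⇒≥ ω≮0) (ω-mono-< q<z))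
          (subst₂ _≤_ (emb-w² z) emb-Δ (emb-mono-≤ w²≤Δ)))
      }

    <-multiple : ∀ z → w z ℤ.< ℤ.0ℤ ⊎ w z ℤ.* w z ℤ.< Δ → fromℤ z <ℝ n ·ℕ ρ₀ δ
    <-multiple z h = let q , z<q , lq = lower-open X {emb z} (below h) in q , z<q , lq
      where
      below : w z ℤ.< ℤ.0ℤ ⊎ w z ℤ.* w z ℤ.< Δ → lower X (emb z)
      below (inj₁ w<0)  = lower-X-below (emb z) (subst (_< 0ℚ) (emb-w z) (emb-mono-< w<0))
      below (inj₂ w²<Δ) = lower-X (emb z) (subst₂ _<_ (emb-w² z) emb-Δ (emb-mono-< w²<Δ))

    multiple-< : ∀ z → ℤ.0ℤ ℤ.≤ Δ → ℤ.0ℤ ℤ.< w z → Δ ℤ.< w z ℤ.* w z → n ·ℕ ρ₀ δ <ℝ fromℤ z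
    multiple-< z 0≤Δ 0<w Δ<w² =
      let q , q<z , uq = upper-open X {emb z} (upper-X (emb z) (0≤Δ̂ 0≤Δ)
            (subst (0ℚ <_) (emb-w z) (emb-mono-< 0<w))
            (subst₂ _<_ emb-Δ (emb-w² z) (emb-mono-< Δ<w²)))
      in q , uq , q<z

    -- A point of the lower cut at or above `z` could be moved strictly above `z`, where the squares
    -- compare strictly and put it in the upper cut as well.
    multiple-≤ : ∀ z → ℤ.0ℤ ℤ.≤ Δ → ℤ.0ℤ ℤ.≤ w z → Δ ℤ.≤ w z ℤ.* w z → n ·ℕ ρ₀ δ ≤ℝ fromℤ z
    multiple-≤ z 0≤Δ 0≤w Δ≤w² q lq = case q ℚ.<? emb z of λ
      { (yes q<z) → q<z
      ; (no  q≮z) → case lower-open X {q} lq of λ (q′ , q<q′ , lq′) →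
          let z<q′ = ω-mono-< (ℚ.≤-<-trans (ℚ.≮⇒≥ q≮z) q<q′)
              0≤ω = subst (0ℚ ≤_) (emb-w z) (emb-mono-≤ 0≤w)
          in ⊥-elim (disjoint X {q′} lq′ (upper-X q′ (0≤Δ̂ 0≤Δ) (ℚ.≤-<-trans 0≤ω z<q′)
               (ℚ.≤-<-trans (subst₂ _≤_ emb-Δ (emb-w² z) (emb-mono-≤ Δ≤w²)) (square-mono 0≤ω z<q′))))
      }

  represents-fromℚ : ∀ β → Represents (fromℚ β) β
  represents-fromℚ β = record { below = λ a<β → a<β ; above = λ β<a → β<a }

  represents-quotient : ∀ n .{{_ : ℕ.NonZero n}} k {δ} → n ·ℕ δ ≃ℝ fromℤ k → Represents δ (k / n)
  represents-quotient n k {δ} (nδ≤k , k≤nδ) = record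
    { below = λ {a} a<β → subst (lower δ) (*-÷ a N)
        (k≤nδ (a * N) (subst (a * N <_) (/-*-emb k n) (ℚ.*-monoˡ-<-pos N a<β)))
    ; above = λ {a} β<a → subst (upper δ) (*-÷ a N)
        (≤ℝ-upper {n ·ℕ δ} {fromℤ k} nδ≤k {a * N} (subst (_< a * N) (/-*-emb k n) (ℚ.*-monoˡ-<-pos N β<a)))
    }
    where
    N : ℚ
    N = emb (+ n)
    instance
      N>0 : Positive N
      N>0 = ℚ.normalize-pos n 1
      N≢0 : NonZero N
      N≢0 = ℚ.pos⇒nonZero N

  module _ (n : ℕ) .{{_ : ℕ.NonZero n}} (d : ℤ) where

    private
      N : ℚ
      N = emb (+ n)
      instance
        N>0 : Positive N
        N>0 = ℚ.normalize-pos n 1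

    ½≤/⇒ : ½ ≤ d / n → + n ℤ.≤ + 2 ℤ.* d
    ½≤/⇒ h = emb-cancel-≤ (subst₂ _≤_
      (trans (sym (ℚ.*-assoc 2ℚ ½ N)) (ℚ.*-identityˡ N))
      (trans (cong (2ℚ *_) (/-*-emb d n)) (sym (emb-* (+ 2) d)))
      (ℚ.*-monoˡ-≤-nonNeg 2ℚ (ℚ.*-monoʳ-≤-nonNeg N {{nonNegative (ℚ.<⇒≤ (ℚ.positive⁻¹ N))}} h)))

    /≤1⇒ : d / n ≤ 1ℚ → d ℤ.≤ + n
    /≤1⇒ h = emb-cancel-≤ (subst₂ _≤_ (/-*-emb d n) (ℚ.*-identityˡ N)
      (ℚ.*-monoʳ-≤-nonNeg N {{nonNegative (ℚ.<⇒≤ (ℚ.positive⁻¹ N))}} h))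

  fromℚ-cancel-≤ : ∀ {p q} → fromℚ p ≤ℝ fromℚ q → p ≤ q
  fromℚ-cancel-≤ {p} {q} h = ℚ.≮⇒≥ λ q<p → ℚ.<-irrefl refl (h q q<p)

  represents-≤ : ∀ {δ β p} → Represents δ β → δ ≤ℝ fromℚ p → β ≤ p
  represents-≤ {β = β} {p} rep h = ℚ.≮⇒≥ λ p<β →
    case ℚ.<-dense p<β of λ (m , p<m , m<β) → ℚ.<-asym p<m (h m (Represents.below rep m<β))

  represents-> : ∀ {δ β p} → Represents δ β → fromℚ p <ℝ δ → p < β
  represents-> rep (q , p<q , lq) = ℚ.<-trans p<q (lower⇒< rep lq)

-- Floor, ceiling and the two halves of the theorem

module Thresholds where

  open RegularSubgraphs
  open RationalRoots using
    (Represents; module Scaled; represents-fromℚ; represents-quotient; represents-≤; represents->;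
     ½≤/⇒; /≤1⇒; fromℚ-cancel-≤)
  open import Data.Empty using (⊥-elim)
  open import Data.Integer.Base hiding (suc; _/_; NonZero)
  open import Data.Integer.Properties as ℤ using
    (≤-trans; <⇒≤; <⇒≱; ≰⇒>; ≮⇒≥; _≤?_; neg-mono-<; neg-mono-≤; i≤j⇒0≤j-i; +-identityʳ; +-monoʳ-≤; drop‿+≤+)
  open import Data.Integer.Tactic.RingSolver using (solve-∀)
  open import Data.Nat.Base as ℕ using (ℕ; NonZero)
  import Data.Nat.Properties as ℕ
  open import Data.Product.Base using (∃; ∃-syntax; _×_; _,_)
  open import Data.Rational.Base using (½; 1ℚ; _/_)
  import Data.Rational.Properties as ℚ
  open import Data.Sum.Base using (_⊎_; inj₁; inj₂)
  open import Function.Base using (_∘_; case_of_)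
  open import Relation.Binary.PropositionalEquality using (_≡_; refl; sym; subst)
  open import Relation.Nullary using (yes; no; ¬_)
  open import Relation.Nullary.Decidable using (_⊎-dec_)
  open import Relation.Unary using (Decidable)

  last-true : ∀ {P : ℕ → Set} → Decidable P → P 0 → ∀ b → ¬ P b → ∃ λ r → P r × ¬ P (ℕ.suc r)
  last-true P? P0 ℕ.zero    ¬Pb = ⊥-elim (¬Pb P0)
  last-true P? P0 (ℕ.suc b) ¬Pb with P? b
  ... | yes Pb = b , Pb , ¬Pb
  ... | no ¬Pb = last-true P? P0 b ¬Pb

  module Rounding (n : ℕ) .{{_ : NonZero n}} (d : ℕ) (n≤2d : 0ℤ ≤ + 2 * + d - + n) where

    private
      0<n : 0ℤ < + n
      0<n = +<+ (ℕ.>-nonZero⁻¹ n)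

      w : ℤ → ℤ
      w z = + 2 * z - + d

      Δ : ℤ
      Δ = + n * (+ 2 * + d - + n)

    0≤Δ : 0ℤ ≤ Δ
    0≤Δ = 0≤* (<⇒≤ 0<n) n≤2d

    private
      -- Decidable integer forms of `r ≤ n ρ₀` and `r < n ρ₀`.
      AtMost Below : ℕ → Set
      AtMost r = w (+ r) ≤ 0ℤ ⊎ w (+ r) * w (+ r) ≤ Δ
      Below  r = w (+ r) < 0ℤ ⊎ w (+ r) * w (+ r) < Δ

      opaque
        -- The search starts at `n + d`, where `w` is `2n + d` and its square clearly exceeds
        -- `n (2d − n)`.
        0<w-large : 0ℤ < w (+ (n ℕ.+ d))
        0<w-large = 0≤⇒< (subst (0ℤ ≤_) (alg (+ n) (+ d)) (0≤+ (0≤+ (<⇒0≤ 0<n) (<⇒≤ 0<n)) (+≤+ {0} {d} ℕ.z≤n)))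
          where
          alg : ∀ n d → n - 0ℤ - 1ℤ + n + d ≡ + 2 * (n + d) - d - 0ℤ - 1ℤ
          alg = solve-∀

        Δ<w²-large : Δ < w (+ (n ℕ.+ d)) * w (+ (n ℕ.+ d))
        Δ<w²-large = 0≤⇒< {Δ} {w (+ (n ℕ.+ d)) * w (+ (n ℕ.+ d))} (subst (0ℤ ≤_) (alg (+ n) (+ d)) (0≤+ {_} {_}
          (0≤+ (0≤+ (<⇒0≤ 0<n) (0≤* {+ n} {+ n - 0ℤ - 1ℤ} (<⇒≤ 0<n) (<⇒0≤ 0<n)))
               (0≤* (+≤+ {0} {4} ℕ.z≤n) (0≤square (+ n))))
          (0≤+ (0≤* (0≤* {+ 2} (+≤+ ℕ.z≤n) (<⇒≤ 0<n)) (+≤+ {0} {d} ℕ.z≤n)) (0≤square (+ d)))))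
          where
          alg : ∀ n d → n - 0ℤ - 1ℤ + n * (n - 0ℤ - 1ℤ) + + 4 * (n * n) + (+ 2 * n * d + d * d) ≡
            (+ 2 * (n + d) - d) * (+ 2 * (n + d) - d) - n * (+ 2 * d - n) - 1ℤ
          alg = solve-∀

        0<d : 0ℤ < + d
        0<d = ≰⇒> λ d≤0 → 0≰-1 (0≤+ (0≤+ n≤2d (<⇒0≤ 0<n)) (0≤+ (i≤j⇒0≤j-i d≤0) (i≤j⇒0≤j-i d≤0))) (alg (+ n) (+ d))
          where
          alg : ∀ n d → + 2 * d - n + (n - 0ℤ - 1ℤ) + (0ℤ - d + (0ℤ - d)) ≡ -1ℤ
          alg = solve-∀

        w0<0 : w 0ℤ < 0ℤ
        w0<0 = subst (_< 0ℤ) (alg (+ d)) (neg-mono-< 0<d)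
          where
          alg : ∀ d → - d ≡ + 2 * 0ℤ - d
          alg = solve-∀

    floor : ∃ λ r → AtMost r × ¬ AtMost (ℕ.suc r)
    floor = last-true (λ r → (w (+ r) ≤? 0ℤ) ⊎-dec (w (+ r) * w (+ r) ≤? Δ)) (inj₁ (<⇒≤ w0<0)) (n ℕ.+ d)
      λ { (inj₁ le) → <⇒≱ 0<w-large le ; (inj₂ le) → <⇒≱ Δ<w²-large le }

    ceiling : ∃ λ r → Below r × ¬ Below (ℕ.suc r)
    ceiling = last-true (λ r → (w (+ r) ℤ.<? 0ℤ) ⊎-dec (w (+ r) * w (+ r) ℤ.<? Δ)) (inj₁ w0<0) (n ℕ.+ d)
      λ { (inj₁ lt) → <⇒≱ 0<w-large (<⇒≤ lt) ; (inj₂ lt) → <⇒≱ Δ<w²-large (<⇒≤ lt) }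

    opaque
      -- The `1` is for `AtMost r` holding by sign alone: then `w` is at most 0 at `r` but positive
      -- at `r + 1`, hence at least `-1` at `r`.
      floor-discriminant : ∀ r → AtMost r → ¬ AtMost (ℕ.suc r) → w (+ r) * w (+ r) ≤ Δ + 1ℤ
      floor-discriminant r (inj₂ h) _ = ≤-trans h (subst (_≤ Δ + 1ℤ) (+-identityʳ Δ) (+-monoʳ-≤ Δ (+≤+ {0} {1} ℕ.z≤n)))
      floor-discriminant r (inj₁ w≤0) ¬next = certify
        (0≤+ 0≤Δ (0≤* {1ℤ - w (+ r)} {w (+ r) + 1ℤ} (0≤+ {1ℤ} (+≤+ ℕ.z≤n) (neg-mono-≤ w≤0)) -1≤w)) (alg (w (+ r)) Δ)
        where
        alg : ∀ w Δ → Δ + 1ℤ - w * w ≡ Δ + (1ℤ - w) * (w + 1ℤ)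
        alg = solve-∀
        alg′ : ∀ r d → + 2 * (1ℤ + r) - d - 0ℤ - 1ℤ ≡ + 2 * r - d + 1ℤ
        alg′ = solve-∀
        -1≤w : 0ℤ ≤ w (+ r) + 1ℤ
        -1≤w = subst (0ℤ ≤_) (alg′ (+ r) (+ d)) (<⇒0≤ (≰⇒> (¬next ∘ inj₁)))

      -- In the second case `Δ = d² − (n − d)²` is at most `d²`, so `2r − d` cannot exceed `d`.
      floor-≤ : ∀ r → AtMost r → 0ℤ ≤ + d - + r
      floor-≤ r (inj₁ w≤0) = subst (0ℤ ≤_) (alg (+ d) (+ r)) (0≤+ (i≤j⇒0≤j-i w≤0) (+≤+ {0} {r} ℕ.z≤n))
        where
        alg : ∀ d r → 0ℤ - (+ 2 * r - d) + r ≡ d - r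
        alg = solve-∀
      floor-≤ r (inj₂ w²≤Δ) = i≤j⇒0≤j-i {+ r} {+ d} (≮⇒≥ λ d<r →
        0≰-4 (0≤+ (0≤+ (i≤j⇒0≤j-i w²≤Δ) (0≤square (+ n - + d)))
                  (0≤+ (0≤* (0≤* {+ 4} (+≤+ ℕ.z≤n) (+≤+ {0} {r} ℕ.z≤n)) (<⇒0≤ d<r))
                       (0≤* {+ 4} (+≤+ ℕ.z≤n) (0≤+ (<⇒0≤ d<r) (+≤+ {0} {d} ℕ.z≤n)))))
          (alg (+ n) (+ d) (+ r)))
        where
        0≰-4 : ∀ {z} → 0ℤ ≤ z → ¬ z ≡ - + 4
        0≰-4 () refl
        alg : ∀ n d r → n * (+ 2 * d - n) - (+ 2 * r - d) * (+ 2 * r - d) + (n - d) * (n - d)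
          + (+ 4 * r * (r - d - 1ℤ) + + 4 * (r - d - 1ℤ + d)) ≡ - + 4
        alg = solve-∀

      -- Both `4r(d − r) = d² − w²` and `Δ = d² − (n − d)²` are differences from `d²`.
      discriminant : ∀ r → w (+ r) * w (+ r) ≤ Δ + 1ℤ →
        (+ n - + d) * (+ n - + d) ≤ + 4 * (+ r * (+ d - + r)) + 1ℤ
      discriminant r h = certify (i≤j⇒0≤j-i h) (alg (+ n) (+ d) (+ r))
        where
        alg : ∀ n d r → + 4 * (r * (d - r)) + 1ℤ - (n - d) * (n - d)
          ≡ n * (+ 2 * d - n) + 1ℤ - (+ 2 * r - d) * (+ 2 * r - d)
        alg = solve-∀

  floor-spanning : ∀ (n : ℕ) .{{_ : NonZero n}} (G : Balanced n) →
    let δ = fromℚ (+ minDegree G / n) in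
    fromℚ ½ ≤ℝ δ → ∃[ r ] (IsFloor (+ r) (n ·ℕ ρ₀ δ) × HasRegularSpanningSubgraph r G)
  floor-spanning n G ½≤δ = result floor
    where
    d = minDegree G
    n≤2d : 0ℤ ≤ + 2 * + d - + n
    n≤2d = i≤j⇒0≤j-i (½≤/⇒ n (+ d) (fromℚ-cancel-≤ ½≤δ))
    open Rounding n d n≤2d
    open Scaled n (+ d) (represents-fromℚ (+ d / n))
    result : _ → ∃[ r ] (IsFloor (+ r) (n ·ℕ ρ₀ (fromℚ (+ d / n))) × HasRegularSpanningSubgraph r G)
    result (r , atMost , ¬next) = r ,
      (≤-multiple (+ r) atMost , multiple-< (+ ℕ.suc r) 0≤Δ (≰⇒> (¬next ∘ inj₁)) (≰⇒> (¬next ∘ inj₂))) ,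
      regular-spanning G (+ d) (λ v → +≤+ (minDegree≤degree G v)) r (floor-≤ r atMost)
        (discriminant r (floor-discriminant r atMost ¬next))

  ceiling-sharp : ∀ (δ : ℝ) → fromℚ ½ <ℝ δ → δ ≤ℝ fromℚ 1ℚ →
    ∀ (n : ℕ) .{{_ : NonZero n}} → IsInteger (n ·ℕ δ) →
    ∃[ G ] (fromℤ (+ minDegree {n} {n} G) ≃ℝ n ·ℕ δ ×
      ∃[ c ] (IsCeiling c (n ·ℕ ρ₀ δ) × (∀ (r : ℕ) → + r > c → ¬ HasRegularSpanningSubgraph r G)))
  ceiling-sharp δ ½<δ δ≤1 n (k , nδ≃k) = natural k refl
    where
    rep : Represents δ (k / n)
    rep = represents-quotient n k nδ≃k
    n≤2k : + n ≤ + 2 * k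
    n≤2k = ½≤/⇒ n k (ℚ.<⇒≤ (represents-> rep ½<δ))
    k≤n : k ≤ + n
    k≤n = /≤1⇒ n k (represents-≤ rep δ≤1)

    Goal : Set
    Goal = ∃[ G ] (fromℤ (+ minDegree {n} {n} G) ≃ℝ n ·ℕ δ ×
      ∃[ c ] (IsCeiling c (n ·ℕ ρ₀ δ) × (∀ (r : ℕ) → + r > c → ¬ HasRegularSpanningSubgraph r G)))

    natural : ∀ z → k ≡ z → Goal
    natural -[1+ _ ] refl = case ≤-trans (+≤+ {0} {n} ℕ.z≤n) n≤2k of λ ()
    natural (+ d) refl = result ceiling
      where
      n≤2d : 0ℤ ≤ + 2 * + d - + n
      n≤2d = i≤j⇒0≤j-i n≤2k
      open Rounding n d n≤2d
      open Scaled n (+ d) rep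
      result : _ → Goal
      result (r , below , ¬next) =
        -- `r` lies strictly below `n ρ₀` and `r + 1` does not, so the ceiling is `r + 1`. The
        -- failure of `Below` there supplies both inequalities that the extremal graph needs.
        let c = + ℕ.suc r
            0≤w  = ≮⇒≥ (¬next ∘ inj₁)
            Δ≤w² = ≮⇒≥ (¬next ∘ inj₂)
            nδ≤d , d≤nδ = nδ≃k
            G , eq , impossible = extremal-graph n d c (drop‿+≤+ k≤n) n≤2d 0≤w Δ≤w²
        in G , subst (λ m → fromℤ (+ m) ≃ℝ n ·ℕ δ) (sym eq) (d≤nδ , nδ≤d) ,
           c , (<-multiple (+ r) below , multiple-≤ c 0≤Δ 0≤w Δ≤w²) , impossible

open import Data.Integer.Base using (+_; _>_)
open import Data.Nat.Base using (ℕ; _≤_; NonZero)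
open import Data.Product.Base using (∃-syntax; _×_; _,_)
open import Data.Rational.Base using (½; 1ℚ; _/_)
open import Relation.Nullary using (¬_)

theorem1 :
  (∀ (n : ℕ) .{{_ : NonZero n}} (G : Balanced n) →
     let δ = fromℚ (+ minDegree G / n) in
     fromℚ ½ ≤ℝ δ →
     ∃[ r ] (IsFloor (+ r) (n ·ℕ ρ₀ δ) × HasRegularSpanningSubgraph r G))
  ×
  (∀ (δ : ℝ) → fromℚ ½ <ℝ δ → δ ≤ℝ fromℚ 1ℚ →
     ∃[ N ] (∀ (n : ℕ) .{{_ : NonZero n}} → N ≤ n → IsInteger (n ·ℕ δ) →
       ∃[ G ] (fromℤ (+ minDegree {n} {n} G) ≃ℝ n ·ℕ δ ×
         ∃[ c ] (IsCeiling c (n ·ℕ ρ₀ δ) ×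
           (∀ (r : ℕ) → + r > c → ¬ HasRegularSpanningSubgraph r G)))))
theorem1 = Thresholds.floor-spanning ,
  λ δ ½<δ δ≤1 → 0 , λ n _ → Thresholds.ceiling-sharp δ ½<δ δ≤1 n
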